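{- There is an absolute constant $C>0$ such that the following holds. Let $P$ be a poset of height $h$ and let $k$ and $n$ be positive integers such that $n\ge 2\log_2|P|$. Let $w$ be the width of $[k]^n$. If a family $\mathcal{F}\subset[k]^n$ does not contain a weak copy of $P$, then $$|\mathcal{F}|\le C\, w\, h\,\log^{3/2}|P|.$$ In particular, $\mathrm{La}(n,P)\le C\binom{n}{\lfloor n/2\rfloor}h\log^{3/2}|P|$.
   Context: $[k]^n$ denotes the set of vectors $(a_1,\dots,a_n)$ with $a_i\in\{1,\dots,k\}$, partially ordered coordinatewise. The width of a poset is the size of its largest antichain; the height is the size of its largest chain. For posets $P,Q$, a weak copy of $P$ in $Q$ is a subset $P'\subset Q$ with a bijection $\pi:P\to P'$ such that $x\le_P y$ implies $\pi(x)\le_Q\pi(y)$. $\mathrm{La}(n,P)$ is the maximum size of a family $\mathcal{F}\subset 2^{[n]}$ (subsets of $\{1,\dots,n\}$ ordered by inclusion, isomorphic to $[2]^n$) containing no weak copy of $P$. The $O(\cdot)$ of the paper is rendered as an absolute constant $C$. -}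

module Defs where

open import Data.Nat using (ℕ; _≤_)
open import Data.Fin using (Fin; toℕ)
open import Data.Vec using (Vec; lookup)
open import Data.List using (List; length)
open import Data.List.Relation.Unary.Unique.Propositional using (Unique)
open import Data.List.Relation.Unary.AllPairs using (AllPairs)
open import Data.List.Membership.Propositional using (_∈_)
open import Data.Product using (Σ; _×_)
open import Data.Sum using (_⊎_)
open import Relation.Nullary using (¬_)
open import Relation.Binary.PropositionalEquality using (_≡_)
open import Relation.Binary.Structures using (IsPartialOrder)
open import Function.Definitions using (Injective)

record FinPoset : Set₁ where
  field
    size : ℕ
    _≼_ : Fin size → Fin size → Set
    isPartialOrder : IsPartialOrder _≡_ _≼_

module _ {A : Set} (R : A → A → Set) where

  Comparable : A → A → Set
  Comparable x y = R x y ⊎ R y x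

  IsChain : List A → Set
  IsChain xs = Unique xs × AllPairs Comparable xs

  IsAntichain : List A → Set
  IsAntichain xs = Unique xs × AllPairs (λ x y → ¬ Comparable x y) xs

  IsHeight : ℕ → Set
  IsHeight h = Σ (List A) (λ xs → IsChain xs × length xs ≡ h)
             × ((xs : List A) → IsChain xs → length xs ≤ h)

  IsWidth : ℕ → Set
  IsWidth w = Σ (List A) (λ xs → IsAntichain xs × length xs ≡ w)
            × ((xs : List A) → IsAntichain xs → length xs ≤ w)

ContainsWeakCopy : (P : FinPoset) {A : Set} (R : A → A → Set) → List A → Set
ContainsWeakCopy P {A} R F =
  Σ (Fin (FinPoset.size P) → A) λ π →
    Injective _≡_ _≡_ π
    × ((x : Fin (FinPoset.size P)) → π x ∈ F)
    × ((x y : Fin (FinPoset.size P)) → FinPoset._≼_ P x y → R (π x) (π y))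

-- the grid [k]^n, coordinates in Fin k (i.e. {1..k} shifted to {0..k-1})
Grid : ℕ → ℕ → Set
Grid k n = Vec (Fin k) n

_≤ᵍ_ : {k n : ℕ} → Grid k n → Grid k n → Set
_≤ᵍ_ {k} {n} u v = (i : Fin n) → toℕ (lookup u i) ≤ toℕ (lookup v i)

{-# OPTIONS --safe #-}
module Submission where

-- Put L = ⌈log₂|P|⌉, d = L + 1 and m = ⌊n/d⌋. Splitting all but fewer than d of the n coordinates
-- into d blocks of length m and decomposing each [k]^m into W symmetric chains partitions [k]^n
-- into grids s₁ × … × s_d. In such a grid, F has at most O(h T(s)) points, T(s) = ∑ᵢ ∏ⱼ≠ᵢ sⱼ.
-- Indeed, cut the grid into cells of side 2, 4, 8, …. A cell is rich if it has at least |P| points of F.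
-- Cells on a common diagonal are strictly ordered in every coordinate, so h rich cells on one
-- diagonal would contain P, one level per cell. Hence there are at most h T(s/2^i) rich cells
-- of side 2^i, with at most 2^d points if i = 1, and at most 2^d |P| ≤ 4^d points not lying in a
-- smaller rich cell if i ≥ 2, while T(s/2^i) ≈ T(s)/2^(i(d-1)); these bounds sum to O(h T(s)).
-- Summing over the grids gives |F| ≤ O(h d W k^(n-m)). Finally W = O(k^(m-1)/√m), by a
-- Littlewood–Offord argument that uses the symmetric chains of {0,1}^(m-1), and by Chebyshev's
-- inequality the width of [k]^n is at least a constant times k^(n-1)/√n.

-- The exponent 3/2 has two sources. Each `T` has d terms, which costs a factor d; and W is
-- estimated in dimension m ≈ n/d while the width is compared in dimension n, which costs √d. The
-- obstacle is rounding: sides are halved upwards, so T(s/2^i) need not shrink like 2^(-i(d-1)) once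
-- sides are short. Two devices deal with this. For sides 2 and 4 the full decrease is needed, and
-- it holds up to a constant as soon as ∑ 1/sᵢ ≤ 1/4; otherwise the whole grid has at most 4 T(s)
-- points and nothing has to be shown. For larger cells the weak decrease T(⌈s/2⌉) ≤ (3/4) T(s)
-- suffices, and this survives rounding until all sides are 1. Every estimate with a square root or
-- the power 3/2 is squared and cleared of denominators, so that the whole argument stays in ℕ.

open import Defs
open import Data.Bool using (Bool; true; false)
open import Data.Empty using (⊥-elim)
open import Data.Fin as Fin using (Fin; zero; suc; toℕ; fromℕ<)
open import Data.Fin.Properties as Fin using (toℕ<n; toℕ-injective; toℕ-fromℕ<; inject≤-injective; toℕ-inject≤; sequence)
open import Data.Fin.Subset using (Subset; _⊆_)
open import Data.List using (List; []; _∷_; _++_; length; map; filter; upTo; cartesianProductWith; concatMap; allFin; tabulate)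
open import Data.List.Membership.Propositional using (_∈_; lose; find)
open import Data.List.Membership.Propositional.Properties
  using (∈-filter⁺; ∈-filter⁻; ∈-upTo⁺; ∈-++⁺ˡ; ∈-++⁺ʳ; ∈-map⁺; ∈-lookup;
         ∈-cartesianProductWith⁺; ∈-cartesianProductWith⁻)
open import Data.List.Properties using (map-∘; length-map; length-++; length-upTo; upTo-∷ʳ; map-tabulate; filter-accept; filter-reject)
open import Data.List.Relation.Unary.All as All using (All; []; _∷_)
import Data.List.Relation.Unary.All.Properties as All
open import Data.List.Relation.Unary.AllPairs as AllPairs using (AllPairs; []; _∷_)
import Data.List.Relation.Unary.AllPairs.Properties as AllPairs
open import Data.List.Relation.Unary.Any as Any using (Any; here; there)
import Data.List.Relation.Unary.Any.Properties as Any
open import Data.List.Relation.Unary.Unique.Propositional using (Unique)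
import Data.List.Relation.Unary.Unique.Propositional.Properties as Unique
open import Data.Nat
open import Data.Nat.Combinatorics using (_C_; nC1≡n; nCk≡nC[n∸k]; k>n⇒nCk≡0; nCk+nC[k+1]≡[n+1]C[k+1])
open import Data.Nat.DivMod using (m≡m%n+[m/n]*n; m%n<n; m≥n⇒m/n>0)
open import Data.Nat.ListAction using (sum)
open import Data.Nat.Logarithm using (⌈log₂_⌉; ⌈log₂⌉-mono-≤; ⌈log₂⌈n/2⌉⌉≡⌈log₂n⌉∸1; ⌈log₂2^n⌉≡n)
open import Data.Nat.Properties
open import Data.Nat.Tactic.RingSolver using (solve-∀)
open import Data.Product using (Σ; _×_; _,_; proj₁; proj₂; map₂)
open import Data.Sum using (_⊎_; inj₁; inj₂)
open import Data.Vec as Vec using (Vec; []; _∷_; here; there)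
import Data.Vec.Properties as Vec
open import Data.Vec.Relation.Unary.All as VecAll using ([]; _∷_)
open import Data.Vec.Relation.Unary.Any as VecAny using (here; there)
open import Data.Vec.Relation.Binary.Pointwise.Inductive as Pointwise using (Pointwise; []; _∷_)
open import Function using (_∘_; id; case_of_)
open import Function.Definitions using (Injective)
open import Relation.Binary.Definitions using (Reflexive; tri<; tri≈; tri>)
open import Relation.Binary.PropositionalEquality
  using (_≡_; _≢_; refl; sym; trans; cong; cong₂; subst; subst₂; module ≡-Reasoning)
open import Relation.Nullary using (¬_; Dec; yes; no; ¬?; _×-dec_)
open import Relation.Nullary.Decidable using (decidable-stable)
open import Effect.Monad using (RawMonad)
open import Relation.Nullary.Negation using (¬¬-map; ¬¬-Monad)
open import Relation.Binary.Structures using (IsPartialOrder)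
open import Relation.Unary using (Decidable)

private
  variable
    A B I X Y : Set
    d m : ℕ

-- Finite sums and counting over lists

∑ : List A → (A → ℕ) → ℕ
∑ xs f = sum (map f xs)

∑-mono : ∀ (xs : List A) {f g : A → ℕ} → (∀ {x} → x ∈ xs → f x ≤ g x) → ∑ xs f ≤ ∑ xs g
∑-mono []       f≤g = z≤n
∑-mono (x ∷ xs) f≤g = +-mono-≤ (f≤g (here refl)) (∑-mono xs (f≤g ∘ there))

∑-cong : ∀ (xs : List A) {f g : A → ℕ} → (∀ x → f x ≡ g x) → ∑ xs f ≡ ∑ xs g
∑-cong []       f≡g = refl
∑-cong (x ∷ xs) f≡g = cong₂ _+_ (f≡g x) (∑-cong xs f≡g)

∑-const : ∀ (xs : List A) c → ∑ xs (λ _ → c) ≡ length xs * c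
∑-const []       c = refl
∑-const (x ∷ xs) c = cong (c +_) (∑-const xs c)

∑-+ : ∀ (xs : List A) (f g : A → ℕ) → ∑ xs (λ x → f x + g x) ≡ ∑ xs f + ∑ xs g
∑-+ []       f g = refl
∑-+ (x ∷ xs) f g = trans (cong (f x + g x +_) (∑-+ xs f g)) (swap (f x) (g x) (∑ xs f) (∑ xs g))
  where
  swap : ∀ a b c d → a + b + (c + d) ≡ a + c + (b + d)
  swap = solve-∀

∑-*ˡ : ∀ (xs : List A) c (f : A → ℕ) → ∑ xs (λ x → c * f x) ≡ c * ∑ xs f
∑-*ˡ []       c f = sym (*-zeroʳ c)
∑-*ˡ (x ∷ xs) c f = trans (cong (c * f x +_) (∑-*ˡ xs c f)) (sym (*-distribˡ-+ c (f x) (∑ xs f)))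

∑-++ : ∀ (xs ys : List A) (f : A → ℕ) → ∑ (xs ++ ys) f ≡ ∑ xs f + ∑ ys f
∑-++ []       ys f = refl
∑-++ (x ∷ xs) ys f = trans (cong (f x +_) (∑-++ xs ys f)) (sym (+-assoc (f x) (∑ xs f) (∑ ys f)))

∑-map : ∀ (h : A → B) (xs : List A) (f : B → ℕ) → ∑ (map h xs) f ≡ ∑ xs (f ∘ h)
∑-map h xs f = cong sum (sym (map-∘ xs))

∑-cartesianProductWith : ∀ {Z : Set} (g : A → B → Z) xs ys (f : Z → ℕ) →
  ∑ (cartesianProductWith g xs ys) f ≡ ∑ xs λ x → ∑ ys λ y → f (g x y)
∑-cartesianProductWith g []       ys f = refl
∑-cartesianProductWith g (x ∷ xs) ys f =
  trans (∑-++ (map (g x) ys) _ f)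
        (cong₂ _+_ (∑-map (g x) ys f) (∑-cartesianProductWith g xs ys f))

length-∑ : ∀ (xs : List A) → length xs ≡ ∑ xs (λ _ → 1)
length-∑ xs = trans (sym (*-identityʳ _)) (sym (∑-const xs 1))

length-cartesianProductWith : ∀ {Z : Set} (g : A → B → Z) xs ys →
  length (cartesianProductWith g xs ys) ≡ length xs * length ys
length-cartesianProductWith g xs ys = begin
  length (cartesianProductWith g xs ys)      ≡⟨ length-∑ (cartesianProductWith g xs ys) ⟩
  ∑ (cartesianProductWith g xs ys) (λ _ → 1) ≡⟨ ∑-cartesianProductWith g xs ys (λ _ → 1) ⟩
  (∑ xs λ _ → ∑ ys λ _ → 1)                  ≡⟨ ∑-const xs (∑ ys λ _ → 1) ⟩
  length xs * ∑ ys (λ _ → 1)                 ≡⟨ cong (length xs *_) (sym (length-∑ ys)) ⟩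
  length xs * length ys                      ∎
  where open ≡-Reasoning

module _ {P : A → Set} (P? : Decidable P) where

  count : List A → ℕ
  count xs = length (filter P? xs)

  count-accept : ∀ {x} xs → P x → count (x ∷ xs) ≡ suc (count xs)
  count-accept xs px = cong length (filter-accept P? px)

  count-∷ : ∀ x xs → count xs ≤ count (x ∷ xs)
  count-∷ x xs with P? x
  ... | yes _ = n≤1+n _
  ... | no  _ = ≤-refl

  count-∑ : ∀ xs {f : A → ℕ} → (∀ x → P x → 1 ≤ f x) → count xs ≤ ∑ xs f
  count-∑ []       1≤f = z≤n
  count-∑ (x ∷ xs) 1≤f with P? x
  ... | yes px = +-mono-≤ (1≤f x px) (count-∑ xs 1≤f)
  ... | no  _  = ≤-trans (count-∑ xs 1≤f) (m≤n+m _ _)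

  length-split : ∀ xs → length xs ≡ count xs + length (filter (¬? ∘ P?) xs)
  length-split []       = refl
  length-split (x ∷ xs) with P? x
  ... | yes _ = cong suc (length-split xs)
  ... | no  _ = trans (cong suc (length-split xs)) (sym (+-suc (count xs) _))

count-mono : ∀ {P Q : A → Set} (P? : Decidable P) (Q? : Decidable Q) (xs : List A) →
  (∀ {x} → x ∈ xs → P x → Q x) → count P? xs ≤ count Q? xs
count-mono P? Q? []       imp = z≤n
count-mono P? Q? (x ∷ xs) imp with P? x
... | yes px = ≤-trans (s≤s (count-mono P? Q? xs (imp ∘ there)))
                       (≤-reflexive (sym (count-accept Q? xs (imp (here refl) px))))
... | no _   = ≤-trans (count-mono P? Q? xs (imp ∘ there)) (count-∷ Q? x xs)

count-filter : ∀ {P Q : A → Set} (P? : Decidable P) (Q? : Decidable Q) (xs : List A) →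
  count P? (filter Q? xs) ≤ count P? xs
count-filter P? Q? []       = z≤n
count-filter P? Q? (x ∷ xs) with Q? x
... | no _ = ≤-trans (count-filter P? Q? xs) (count-∷ P? x xs)
... | yes _ with P? x
...   | yes _ = s≤s (count-filter P? Q? xs)
...   | no _  = count-filter P? Q? xs

count-unique : ∀ {P : A → Set} (P? : Decidable P) {xs} → Unique xs →
  (∀ {x y} → x ∈ xs → y ∈ xs → P x → P y → x ≡ y) → count P? xs ≤ 1
count-unique P? {xs} uniq same = go (filter P? xs) (Unique.filter⁺ P? uniq) (∈-filter⁻ P?)
  where
  go : ∀ zs → Unique zs → (∀ {z} → z ∈ zs → z ∈ xs × _) → length zs ≤ 1
  go []          _ _ = z≤n
  go (x ∷ [])    _ _ = s≤s z≤n
  go (x ∷ y ∷ _) ((x≢y ∷ _) ∷ _) sub = ⊥-elim (x≢y (same (proj₁ x′) (proj₁ y′) (proj₂ x′) (proj₂ y′)))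
    where
    x′ = sub (here refl)
    y′ = sub (there (here refl))

count-cover : ∀ {Q : I → A → Set} (Q? : ∀ i → Decidable (Q i)) is xs →
  (∀ {x} → x ∈ xs → Any (λ i → Q i x) is) → length xs ≤ ∑ is λ i → count (Q? i) xs
count-cover Q? is []       cov = z≤n
count-cover {Q = Q} Q? is (x ∷ xs) cov =
  ≤-trans (s≤s (count-cover Q? is xs (cov ∘ there))) (step is (cov (here refl)))
  where
  step : ∀ is → Any (λ i → Q i x) is → suc (∑ is λ i → count (Q? i) xs) ≤ ∑ is λ i → count (Q? i) (x ∷ xs)
  step (i ∷ is) (here q)  = +-mono-≤ (≤-reflexive (sym (count-accept (Q? i) xs q)))
                                     (∑-mono is λ {j} _ → count-∷ (Q? j) x xs)
  step (i ∷ is) (there q) = ≤-trans (≤-reflexive (sym (+-suc _ _))) (+-mono-≤ (count-∷ (Q? i) x xs) (step is q))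

count-cover-const : ∀ {Q : I → A → Set} (Q? : ∀ i → Decidable (Q i)) is xs c →
  (∀ {x} → x ∈ xs → Any (λ i → Q i x) is) → (∀ i → count (Q? i) xs ≤ c) → length xs ≤ length is * c
count-cover-const Q? is xs c cov bound =
  ≤-trans (count-cover Q? is xs cov)
          (≤-trans (∑-mono is λ {i} _ → bound i) (≤-reflexive (∑-const is c)))

-- Boxes in ℕᵈ and their diagonal lines

Π : Vec ℕ d → ℕ
Π []      = 1
Π (x ∷ v) = x * Π v

-- T v = Σᵢ Πⱼ≠ᵢ vⱼ, an upper bound for the number of diagonal lines of the box with sides v.
T : Vec ℕ d → ℕ
T []      = 0
T (x ∷ v) = Π v + x * T v

box : Vec ℕ d → List (Vec ℕ d)
box []      = [] ∷ []
box (x ∷ v) = cartesianProductWith _∷_ (upTo x) (box v)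

-- The first points of the diagonal lines b, b + (1,…,1), b + (2,…,2), … meeting the box.
starts : Vec ℕ d → List (Vec ℕ d)
starts []      = []
starts (x ∷ v) = map (0 ∷_) (box v) ++ cartesianProductWith _∷_ (upTo x) (starts v)

_≪_ : Vec ℕ d → Vec ℕ d → Set
_≪_ = Pointwise _<_

shift : ℕ → Vec ℕ d → Vec ℕ d
shift t = Vec.map (_+ t)

length-box : ∀ (v : Vec ℕ d) → length (box v) ≡ Π v
length-box []      = refl
length-box (x ∷ v) = trans (length-cartesianProductWith _∷_ (upTo x) (box v))
                           (cong₂ _*_ (length-upTo x) (length-box v))

length-starts : ∀ (v : Vec ℕ d) → length (starts v) ≡ T v
length-starts []      = refl
length-starts (x ∷ v) = begin
  length (map (0 ∷_) (box v) ++ cartesianProductWith _∷_ (upTo x) (starts v))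
    ≡⟨ length-++ (map (0 ∷_) (box v)) ⟩
  length (map (0 ∷_) (box v)) + length (cartesianProductWith _∷_ (upTo x) (starts v))
    ≡⟨ cong₂ _+_ (trans (length-map (0 ∷_) (box v)) (length-box v))
                 (trans (length-cartesianProductWith _∷_ (upTo x) (starts v))
                        (cong₂ _*_ (length-upTo x) (length-starts v))) ⟩
  Π v + x * T v ∎
  where open ≡-Reasoning

∈-box : ∀ {c s : Vec ℕ d} → c ≪ s → c ∈ box s
∈-box []          = here refl
∈-box (x<s ∷ c≪s) = ∈-cartesianProductWith⁺ _∷_ (∈-upTo⁺ x<s) (∈-box c≪s)

monus-≪ : ∀ (c : Vec ℕ d) {s} x → c ≪ s → Vec.map (_∸ x) c ≪ s
monus-≪ []      x []          = []
monus-≪ (y ∷ c) x (y<s ∷ c≪s) = ≤-<-trans (m∸n≤m y x) y<s ∷ monus-≪ c x c≪s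

shift-monus : ∀ {x} {b : Vec ℕ d} {t} → x ≤ t → shift t b ≡ shift x (Vec.map (_∸ x) (shift t b))
shift-monus {b = []}    x≤t = refl
shift-monus {b = y ∷ b} {t} x≤t = cong₂ _∷_ (sym (m∸n+n≡m (≤-trans x≤t (m≤n+m t y)))) (shift-monus x≤t)

-- The offset found is the least coordinate of `c`, and the start is `c` minus it. Comparing the
-- head `x` with the offset `t` of the tail decides which of the two parts of `starts` contains that
-- start.
∈-starts : ∀ {c s : Vec ℕ (suc d)} → c ≪ s →
  Any (λ b → Σ ℕ λ t → t < Vec.head s × c ≡ shift t b) (starts s)
∈-starts {zero} {x ∷ []} {s ∷ []} (x<s ∷ []) = here (x , x<s , refl)
∈-starts {suc d} {x ∷ c} {s ∷ v} (x<s ∷ c≪v) with find (∈-starts c≪v)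
... | b , b∈ , t , t<s , refl with x ≤? t
...   | yes x≤t = lose (∈-++⁺ˡ (∈-map⁺ (0 ∷_) (∈-box (monus-≪ c x c≪v))))
                       (x , x<s , cong (x ∷_) (shift-monus {b = b} x≤t))
...   | no x≰t  = lose (∈-++⁺ʳ (map (0 ∷_) (box v))
                         (∈-cartesianProductWith⁺ _∷_ (∈-upTo⁺ (≤-<-trans (m∸n≤m x t) x<s)) b∈))
                       (t , <-trans (≰⇒> x≰t) x<s , cong (_∷ c) (sym (m∸n+n≡m (≰⇒≥ x≰t))))

shift-≪ : ∀ (b : Vec ℕ d) {t u} → t < u → shift t b ≪ shift u b
shift-≪ []      t<u = []
shift-≪ (x ∷ b) t<u = +-monoʳ-< x t<u ∷ shift-≪ b t<u

shift-injective : ∀ (b : Vec ℕ (suc d)) {t u} → shift t b ≡ shift u b → t ≡ u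
shift-injective (x ∷ b) eq = +-cancelˡ-≡ x _ _ (Vec.∷-injectiveˡ eq)

-- Merging cells: dyadic coarsening

half : Vec ℕ d → Vec ℕ d
half = Vec.map ⌊_/2⌋

half↑ : Vec ℕ d → Vec ℕ d
half↑ = Vec.map ⌈_/2⌉

half-≪ : ∀ (c s : Vec ℕ d) → c ≪ s → half c ≪ half↑ s
half-≪ []      []      []          = []
half-≪ (x ∷ c) (s ∷ v) (x<s ∷ c≪s) = ⌊n/2⌋-mono (s≤s x<s) ∷ half-≪ c v c≪s

-- Floor halving is monotone, so a strict gap between merged cells forces one between the cells
-- inside them. This is how order information survives coarsening.
half-reflects-≪ : ∀ (a b : Vec ℕ d) → half a ≪ half b → a ≪ b
half-reflects-≪ []      []      []        = []
half-reflects-≪ (x ∷ a) (y ∷ b) (p ∷ a≪b) =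
  ≰⇒> (λ y≤x → <⇒≱ p (⌊n/2⌋-mono y≤x)) ∷ half-reflects-≪ a b a≪b

children : Vec ℕ d → List (Vec ℕ d)
children []      = [] ∷ []
children (x ∷ c) = cartesianProductWith _∷_ (x + x ∷ suc (x + x) ∷ []) (children c)

length-children : ∀ (c : Vec ℕ d) → length (children c) ≡ 2 ^ d
length-children []      = refl
length-children (x ∷ c) = trans (length-cartesianProductWith _∷_ (x + x ∷ suc (x + x) ∷ []) (children c))
                                (cong (2 *_) (length-children c))

⌊/2⌋-fibre : ∀ x → x ∈ (⌊ x /2⌋ + ⌊ x /2⌋ ∷ suc (⌊ x /2⌋ + ⌊ x /2⌋) ∷ [])
⌊/2⌋-fibre 0 = here refl
⌊/2⌋-fibre 1 = there (here refl)
⌊/2⌋-fibre (suc (suc x)) with ⌊/2⌋-fibre x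
... | here p         = here (cong suc (trans (cong suc p) (sym (+-suc _ _))))
... | there (here p) = there (here (cong suc (trans (cong suc p) (cong suc (sym (+-suc _ _))))))

∈-children : ∀ (c : Vec ℕ d) → c ∈ children (half c)
∈-children []      = here refl
∈-children (x ∷ c) = ∈-cartesianProductWith⁺ _∷_ (⌊/2⌋-fibre x) (∈-children c)

_≟ᵛ_ : (u v : Vec ℕ d) → Dec (u ≡ v)
_≟ᵛ_ = Vec.≡-dec _≟_

module _ {A : Set} (φ : A → Vec ℕ d) where

  fibre : List A → Vec ℕ d → ℕ
  fibre F c = count (λ x → φ x ≟ᵛ c) F

fibre-half : ∀ {A : Set} (φ : A → Vec ℕ d) F q → (∀ c → fibre φ F c ≤ q) →
  ∀ c → fibre (half ∘ φ) F c ≤ 2 ^ d * q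
fibre-half φ F q fib c = ≤-trans
  (count-cover-const (λ e x → φ x ≟ᵛ e) (children c) (filter (λ x → half (φ x) ≟ᵛ c) F) q
    (λ x∈ → lose (subst (λ e → _ ∈ children e) (proj₂ (∈-filter⁻ (λ x → half (φ x) ≟ᵛ c) {xs = F} x∈)) (∈-children (φ _))) refl)
    (λ e → ≤-trans (count-filter (λ x → φ x ≟ᵛ e) (λ x → half (φ x) ≟ᵛ c) F) (fib e)))
  (≤-reflexive (cong (_* q) (length-children c)))

-- `Π` and `T` under scaling, shifting and halving

^-distribʳ-* : ∀ n x y → (x * y) ^ n ≡ x ^ n * y ^ n
^-distribʳ-* zero    x y = refl
^-distribʳ-* (suc n) x y = trans (cong (x * y *_) (^-distribʳ-* n x y)) (ring x y (x ^ n) (y ^ n))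
  where
  ring : ∀ a b c d → a * b * (c * d) ≡ a * c * (b * d)
  ring = solve-∀

Π-mono : ∀ {u v : Vec ℕ d} → Pointwise _≤_ u v → Π u ≤ Π v
Π-mono []        = ≤-refl
Π-mono (x≤y ∷ p) = *-mono-≤ x≤y (Π-mono p)

T-mono : ∀ {u v : Vec ℕ d} → Pointwise _≤_ u v → T u ≤ T v
T-mono []        = ≤-refl
T-mono (x≤y ∷ p) = +-mono-≤ (Π-mono p) (*-mono-≤ x≤y (T-mono p))

Π-scale : ∀ e (v : Vec ℕ d) → Π (Vec.map (e *_) v) ≡ e ^ d * Π v
Π-scale e []                = refl
Π-scale {suc d} e (x ∷ v) rewrite Π-scale e v = ring e x (e ^ d) (Π v)
  where
  ring : ∀ e x p q → e * x * (p * q) ≡ e * p * (x * q)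
  ring = solve-∀

-- `T` is homogeneous of degree d - 1; the factor `e` on the left avoids writing that exponent.
T-scale : ∀ e (v : Vec ℕ d) → e * T (Vec.map (e *_) v) ≡ e ^ d * T v
T-scale e [] = *-zeroʳ e
T-scale {suc d} e (x ∷ v) = begin
  e * (Π ev + e * x * T ev)              ≡⟨ expand e x (Π ev) (T ev) ⟩
  e * Π ev + e * x * (e * T ev)          ≡⟨ cong₂ (λ a b → e * a + e * x * b) (Π-scale e v) (T-scale e v) ⟩
  e * (e ^ d * Π v) + e * x * (e ^ d * T v) ≡⟨ collect e x (e ^ d) (Π v) (T v) ⟩
  e * e ^ d * (Π v + x * T v)            ∎
  where
  open ≡-Reasoning
  ev = Vec.map (e *_) v
  expand : ∀ e x p t → e * (p + e * x * t) ≡ e * p + e * x * (e * t)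
  expand = solve-∀
  collect : ∀ e x f p t → e * (f * p) + e * x * (f * t) ≡ e * f * (p + x * t)
  collect = solve-∀

-- Weierstrass' inequality ∏(1 + e/vᵢ) (1 - ∑ e/vᵢ) ≤ 1 with denominators and subtraction cleared.
Π-shift : ∀ e (v : Vec ℕ d) → Π (shift e v) * Π v ≤ Π v * Π v + e * T v * Π (shift e v)
Π-shift e []      = s≤s z≤n
Π-shift e (x ∷ v) = begin
  (x + e) * P⁺ * (x * P)
    ≡⟨ expand x e P P⁺ ⟩
  x * x * (P⁺ * P) + e * x * (P * P⁺)
    ≤⟨ +-monoˡ-≤ _ (*-monoʳ-≤ (x * x) (Π-shift e v)) ⟩
  x * x * (P * P + e * T v * P⁺) + e * x * (P * P⁺)
    ≤⟨ m≤m+n _ (e * e * (P * P⁺) + e * x * e * (T v * P⁺)) ⟩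
  x * x * (P * P + e * T v * P⁺) + e * x * (P * P⁺) + (e * e * (P * P⁺) + e * x * e * (T v * P⁺))
    ≡⟨ collect x e P P⁺ (T v) ⟩
  x * P * (x * P) + e * (P + x * T v) * ((x + e) * P⁺) ∎
  where
  open ≤-Reasoning
  P  = Π v
  P⁺ = Π (shift e v)
  expand : ∀ x e p q → (x + e) * q * (x * p) ≡ x * x * (q * p) + e * x * (p * q)
  expand = solve-∀
  collect : ∀ x e p q t → x * x * (p * p + e * t * q) + e * x * (p * q) + (e * e * (p * q) + e * x * e * (t * q))
    ≡ x * p * (x * p) + e * (p + x * t) * ((x + e) * q)
  collect = solve-∀

-- For positive sides T v / Π v = ∑ 1/vᵢ, which can only decrease when the sides grow.
T-shift : ∀ e (v : Vec ℕ d) → T (shift e v) * Π v ≤ T v * Π (shift e v)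
T-shift e []      = z≤n
T-shift e (x ∷ v) = begin
  (P⁺ + (x + e) * T (shift e v)) * (x * P)
    ≡⟨ expand x e P P⁺ (T (shift e v)) ⟩
  x * (P * P⁺) + x * (x + e) * (T (shift e v) * P)
    ≤⟨ +-mono-≤ (*-monoˡ-≤ (P * P⁺) (m≤m+n x e)) (*-monoʳ-≤ (x * (x + e)) (T-shift e v)) ⟩
  (x + e) * (P * P⁺) + x * (x + e) * (T v * P⁺)
    ≡⟨ collect x e P P⁺ (T v) ⟩
  (P + x * T v) * ((x + e) * P⁺) ∎
  where
  open ≤-Reasoning
  P  = Π v
  P⁺ = Π (shift e v)
  expand : ∀ x e p q t → (q + (x + e) * t) * (x * p) ≡ x * (p * q) + x * (x + e) * (t * p)
  expand = solve-∀
  collect : ∀ x e p q t → (x + e) * (p * q) + x * (x + e) * (t * q) ≡ (p + x * t) * ((x + e) * q)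
  collect = solve-∀

module _ (v : Vec ℕ d) (4T≤Π : 4 * T v ≤ Π v) (0<Π : 0 < Π v) where

  private instance
    Π≢0 : NonZero (Π v)
    Π≢0 = >-nonZero 0<Π

  -- `4T≤Π` says that ∑ 1/vᵢ ≤ 1/4. Hence ∑ 3/vᵢ ≤ 3/4, and `Π-shift` leaves a factor of at most
  -- 1/(1 - 3/4) = 4.
  Π-shift3 : Π (shift 3 v) ≤ 4 * Π v
  Π-shift3 = *-cancelʳ-≤ _ _ (Π v) (+-cancelʳ-≤ (3 * (P⁺ * P)) (P⁺ * P) (4 * P * P) (begin
    P⁺ * P + 3 * (P⁺ * P)            ≡⟨ four (P⁺ * P) ⟩
    4 * (P⁺ * P)                     ≤⟨ *-monoʳ-≤ 4 (Π-shift 3 v) ⟩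
    4 * (P * P + 3 * T v * P⁺)       ≡⟨ expand P P⁺ (T v) ⟩
    4 * P * P + 3 * (P⁺ * (4 * T v)) ≤⟨ +-monoʳ-≤ (4 * P * P) (*-monoʳ-≤ 3 (*-monoʳ-≤ P⁺ 4T≤Π)) ⟩
    4 * P * P + 3 * (P⁺ * P)         ∎))
    where
    open ≤-Reasoning
    P  = Π v
    P⁺ = Π (shift 3 v)
    four : ∀ x → x + 3 * x ≡ 4 * x
    four = solve-∀
    expand : ∀ p q t → 4 * (p * p + 3 * t * q) ≡ 4 * p * p + 3 * (q * (4 * t))
    expand = solve-∀

  T-shift3 : T (shift 3 v) ≤ 4 * T v
  T-shift3 = *-cancelʳ-≤ _ _ (Π v) (begin
    T (shift 3 v) * Π v ≤⟨ T-shift 3 v ⟩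
    T v * Π (shift 3 v) ≤⟨ *-monoʳ-≤ (T v) Π-shift3 ⟩
    T v * (4 * Π v)     ≡⟨ ring (T v) (Π v) ⟩
    4 * T v * Π v       ∎)
    where
    open ≤-Reasoning
    ring : ∀ t p → t * (4 * p) ≡ 4 * t * p
    ring = solve-∀

  -- Rounding a side up to a multiple of 2 or 4 adds at most 3, which costs a factor 4 by
  -- `T-shift3`. Up to that factor, dividing the sides by `e` still divides `T` by e^(d-1).
  T-div : ∀ e (f : ℕ → ℕ) → (∀ x → e * f x ≤ x + 3) → e ^ d * T (Vec.map f v) ≤ 4 * e * T v
  T-div e f ef≤ = begin
    e ^ d * T (Vec.map f v)                ≡⟨ sym (T-scale e (Vec.map f v)) ⟩
    e * T (Vec.map (e *_) (Vec.map f v))   ≤⟨ *-monoʳ-≤ e (T-mono (below v)) ⟩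
    e * T (shift 3 v)                      ≤⟨ *-monoʳ-≤ e T-shift3 ⟩
    e * (4 * T v)                          ≡⟨ ring e (T v) ⟩
    4 * e * T v                            ∎
    where
    open ≤-Reasoning
    below : ∀ {d} (v : Vec ℕ d) → Pointwise _≤_ (Vec.map (e *_) (Vec.map f v)) (shift 3 v)
    below []      = []
    below (x ∷ v) = ef≤ x ∷ below v
    ring : ∀ e t → e * (4 * t) ≡ 4 * e * t
    ring = solve-∀

2*⌈n/2⌉≤1+n : ∀ n → 2 * ⌈ n /2⌉ ≤ suc n
2*⌈n/2⌉≤1+n 0 = z≤n
2*⌈n/2⌉≤1+n 1 = ≤-refl
2*⌈n/2⌉≤1+n (suc (suc n)) =
  subst (_≤ 3 + n) (sym (*-suc 2 ⌈ n /2⌉)) (+-monoʳ-≤ 2 (2*⌈n/2⌉≤1+n n))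

4*⌈⌈n/2⌉/2⌉≤n+3 : ∀ n → 4 * ⌈ ⌈ n /2⌉ /2⌉ ≤ n + 3
4*⌈⌈n/2⌉/2⌉≤n+3 n = begin
  4 * ⌈ ⌈ n /2⌉ /2⌉       ≡⟨ *-assoc 2 2 ⌈ ⌈ n /2⌉ /2⌉ ⟩
  2 * (2 * ⌈ ⌈ n /2⌉ /2⌉) ≤⟨ *-monoʳ-≤ 2 (2*⌈n/2⌉≤1+n ⌈ n /2⌉) ⟩
  2 * suc ⌈ n /2⌉         ≡⟨ *-suc 2 ⌈ n /2⌉ ⟩
  2 + 2 * ⌈ n /2⌉         ≤⟨ +-monoʳ-≤ 2 (2*⌈n/2⌉≤1+n n) ⟩
  3 + n                   ≡⟨ +-comm 3 n ⟩
  n + 3                   ∎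
  where open ≤-Reasoning

-- Tight at n = 1. In `T-half` the unit lost here on a side that stays 1 is regained from a side ≥ 2
-- by `1+4*⌈n/2⌉≤3*n`, which is tight at n = 3.
4*⌈n/2⌉≤1+3*n : ∀ n → 1 ≤ n → 4 * ⌈ n /2⌉ ≤ 1 + 3 * n
4*⌈n/2⌉≤1+3*n (suc n) _ = begin
  4 * ⌈ suc n /2⌉       ≡⟨ *-assoc 2 2 ⌈ suc n /2⌉ ⟩
  2 * (2 * ⌈ suc n /2⌉) ≤⟨ *-monoʳ-≤ 2 (2*⌈n/2⌉≤1+n (suc n)) ⟩
  2 * (2 + n)           ≤⟨ m≤m+n _ n ⟩
  2 * (2 + n) + n       ≡⟨ ring n ⟩
  1 + 3 * suc n         ∎
  where
  open ≤-Reasoning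
  ring : ∀ n → 2 * (2 + n) + n ≡ 1 + 3 * suc n
  ring = solve-∀

1+4*⌈n/2⌉≤3*n : ∀ n → 2 ≤ n → 1 + 4 * ⌈ n /2⌉ ≤ 3 * n
1+4*⌈n/2⌉≤3*n 1 (s≤s ())
1+4*⌈n/2⌉≤3*n 2 _ = m≤m+n 5 1
1+4*⌈n/2⌉≤3*n (suc (suc (suc n))) _ = begin
  1 + 4 * ⌈ 3 + n /2⌉       ≡⟨ cong suc (*-assoc 2 2 ⌈ 3 + n /2⌉) ⟩
  1 + 2 * (2 * ⌈ 3 + n /2⌉) ≤⟨ s≤s (*-monoʳ-≤ 2 (2*⌈n/2⌉≤1+n (3 + n))) ⟩
  1 + 2 * (4 + n)           ≤⟨ m≤m+n _ n ⟩
  1 + 2 * (4 + n) + n       ≡⟨ ring n ⟩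
  3 * (3 + n)               ∎
  where
  open ≤-Reasoning
  ring : ∀ n → 1 + 2 * (4 + n) + n ≡ 3 * (3 + n)
  ring = solve-∀

Π-half-≤ : ∀ (v : Vec ℕ d) → Π (half↑ v) ≤ Π v
Π-half-≤ []      = ≤-refl
Π-half-≤ (x ∷ v) = *-mono-≤ (⌈n/2⌉≤n x) (Π-half-≤ v)

Π-half-< : ∀ {v : Vec ℕ d} → VecAny.Any (2 ≤_) v → 4 * Π (half↑ v) ≤ 3 * Π v
Π-half-< {v = x ∷ v} (here 2≤x) = begin
  4 * (⌈ x /2⌉ * Π (half↑ v)) ≡⟨ sym (*-assoc 4 ⌈ x /2⌉ _) ⟩
  4 * ⌈ x /2⌉ * Π (half↑ v)   ≤⟨ *-mono-≤ (<⇒≤ (1+4*⌈n/2⌉≤3*n x 2≤x)) (Π-half-≤ v) ⟩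
  3 * x * Π v                 ≡⟨ *-assoc 3 x _ ⟩
  3 * (x * Π v)               ∎
  where open ≤-Reasoning
Π-half-< {v = x ∷ v} (there p) = begin
  4 * (⌈ x /2⌉ * Π (half↑ v)) ≡⟨ ring 4 ⌈ x /2⌉ (Π (half↑ v)) ⟩
  ⌈ x /2⌉ * (4 * Π (half↑ v)) ≤⟨ *-mono-≤ (⌈n/2⌉≤n x) (Π-half-< p) ⟩
  x * (3 * Π v)               ≡⟨ sym (ring 3 x (Π v)) ⟩
  3 * (x * Π v)               ∎
  where
  open ≤-Reasoning
  ring : ∀ c x p → c * (x * p) ≡ x * (c * p)
  ring = solve-∀

Positive : Vec ℕ d → Set
Positive = VecAll.All (1 ≤_)

half↑-positive : ∀ {v : Vec ℕ d} → Positive v → Positive (half↑ v)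
half↑-positive []        = []
half↑-positive (1≤x ∷ p) = ⌈n/2⌉-mono 1≤x ∷ half↑-positive p

ones : ∀ {v : Vec ℕ d} → Positive v → ¬ VecAny.Any (2 ≤_) v → v ≡ Vec.replicate d 1
ones []        _   = refl
ones (1≤x ∷ p) ¬2≤ = cong₂ _∷_ (≤-antisym (≮⇒≥ (¬2≤ ∘ here)) 1≤x) (ones p (¬2≤ ∘ there))

half↑-ones : ∀ d → half↑ (Vec.replicate d 1) ≡ Vec.replicate d 1
half↑-ones zero    = refl
half↑-ones (suc d) = cong (1 ∷_) (half↑-ones d)

Π-ones : ∀ d → Π (Vec.replicate d 1) ≡ 1
Π-ones zero    = refl
Π-ones (suc d) = trans (+-identityʳ _) (Π-ones d)

T-positive : ∀ {v : Vec ℕ (suc d)} → Positive v → 1 ≤ T v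
T-positive (_ ∷ p) = ≤-trans (Π-positive p) (m≤m+n _ _)
  where
  Π-positive : ∀ {d} {v : Vec ℕ d} → Positive v → 1 ≤ Π v
  Π-positive []        = ≤-refl
  Π-positive (1≤x ∷ p) = *-mono-≤ 1≤x (Π-positive p)

-- This geometric decrease makes the sum over all cell sizes converge, also for short sides. Two
-- sides are needed, because with a single side `T` is constantly 1. If the tail has length at least
-- 2 and a side ≥ 2, its `Π` and its `T` both drop by 3/4; what remains is a tail of ones, and the
-- case T = x + y.
T-half : ∀ {v : Vec ℕ (2 + d)} → Positive v → VecAny.Any (2 ≤_) v → 4 * T (half↑ v) ≤ 3 * T v
T-half {v = x ∷ w} (1≤x ∷ pos) any with VecAny.any? (2 ≤?_) w
T-half {d} {x ∷ w} (1≤x ∷ pos) any | no w≤1 with any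
... | there 2≤w = ⊥-elim (w≤1 2≤w)
... | here  2≤x = all-ones (ones pos w≤1)
  where
  all-ones : w ≡ Vec.replicate (suc d) 1 → 4 * T (half↑ (x ∷ w)) ≤ 3 * T (x ∷ w)
  all-ones refl = begin
    4 * (Π (half↑ u) + ⌈ x /2⌉ * T (half↑ u)) ≡⟨ cong (λ h → 4 * (Π h + ⌈ x /2⌉ * T h)) (half↑-ones (suc d)) ⟩
    4 * (Π u + ⌈ x /2⌉ * T u)                 ≡⟨ cong (λ p → 4 * (p + ⌈ x /2⌉ * T u)) (Π-ones (suc d)) ⟩
    4 * (1 + ⌈ x /2⌉ * T u)                   ≡⟨ expand ⌈ x /2⌉ (T u) ⟩
    -- The spare 1 is absorbed by T u ≥ 1, as the tail is nonempty.
    3 + (1 + 4 * ⌈ x /2⌉ * T u)               ≤⟨ +-monoʳ-≤ 3 (+-monoˡ-≤ _ (T-positive pos)) ⟩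
    3 + (T u + 4 * ⌈ x /2⌉ * T u)             ≤⟨ +-monoʳ-≤ 3 (*-monoˡ-≤ (T u) (1+4*⌈n/2⌉≤3*n x 2≤x)) ⟩
    3 + 3 * x * T u                           ≡⟨ collect x (T u) ⟩
    3 * (1 + x * T u)                         ≡⟨ cong (λ p → 3 * (p + x * T u)) (sym (Π-ones (suc d))) ⟩
    3 * (Π u + x * T u)                       ∎
    where
    open ≤-Reasoning
    u = Vec.replicate (suc d) 1
    expand : ∀ y t → 4 * (1 + y * t) ≡ 3 + (1 + 4 * y * t)
    expand = solve-∀
    collect : ∀ y t → 3 + 3 * y * t ≡ 3 * (1 + y * t)
    collect = solve-∀
T-half {zero} {x ∷ y ∷ []} (1≤x ∷ pos) any | yes (here 2≤y) = begin
  4 * (⌈ y /2⌉ * 1 + ⌈ x /2⌉ * (1 + ⌈ y /2⌉ * 0)) ≡⟨ expand ⌈ x /2⌉ ⌈ y /2⌉ ⟩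
  4 * ⌈ x /2⌉ + 4 * ⌈ y /2⌉                       ≤⟨ +-monoˡ-≤ _ (4*⌈n/2⌉≤1+3*n x 1≤x) ⟩
  1 + 3 * x + 4 * ⌈ y /2⌉                         ≡⟨ sym (+-suc (3 * x) _) ⟩
  3 * x + (1 + 4 * ⌈ y /2⌉)                       ≤⟨ +-monoʳ-≤ (3 * x) (1+4*⌈n/2⌉≤3*n y 2≤y) ⟩
  3 * x + 3 * y                                   ≡⟨ collect x y ⟩
  3 * (y * 1 + x * (1 + y * 0))                   ∎
  where
  open ≤-Reasoning
  expand : ∀ x y → 4 * (y * 1 + x * (1 + y * 0)) ≡ 4 * x + 4 * y
  expand = solve-∀
  collect : ∀ x y → 3 * x + 3 * y ≡ 3 * (y * 1 + x * (1 + y * 0))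
  collect = solve-∀
T-half {suc d} {x ∷ w} (1≤x ∷ pos) any | yes 2≤w = begin
  4 * (Π (half↑ w) + ⌈ x /2⌉ * T (half↑ w))         ≡⟨ ring 4 ⌈ x /2⌉ (Π (half↑ w)) (T (half↑ w)) ⟩
  4 * Π (half↑ w) + ⌈ x /2⌉ * (4 * T (half↑ w))     ≤⟨ +-mono-≤ (Π-half-< 2≤w) (*-mono-≤ (⌈n/2⌉≤n x) (T-half pos 2≤w)) ⟩
  3 * Π w + x * (3 * T w)                           ≡⟨ sym (ring 3 x (Π w) (T w)) ⟩
  3 * (Π w + x * T w)                               ∎
  where
  open ≤-Reasoning
  ring : ∀ c x p t → c * (p + x * t) ≡ c * p + x * (c * t)
  ring = solve-∀

-- The bound for a single grid

lookup-< : ∀ {A : Set} {R : A → A → Set} {xs : List A} → AllPairs R xs →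
  ∀ {i j} → i Fin.< j → R (Data.List.lookup xs i) (Data.List.lookup xs j)
lookup-< (px ∷ _)  {zero}  {suc j} _         = All.lookup px (∈-lookup j)
lookup-< (_ ∷ pxs) {suc i} {suc j} (s≤s i<j) = lookup-< pxs i<j

lookup-injective : ∀ {A : Set} {xs : List A} → Unique xs →
  ∀ {i j} → Data.List.lookup xs i ≡ Data.List.lookup xs j → i ≡ j
lookup-injective u {i} {j} eq with Fin.<-cmp i j
... | tri≈ _ i≡j _ = i≡j
... | tri< i<j _ _ = ⊥-elim (lookup-< u i<j eq)
... | tri> _ _ j<i = ⊥-elim (lookup-< u j<i (sym eq))

StrictlyMonotone : (P : FinPoset) (h : ℕ) → (Fin (FinPoset.size P) → Fin h) → Set
StrictlyMonotone P h ht = ∀ {x y} → FinPoset._≼_ P x y → x ≢ y → ht x Fin.< ht y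

module GridBound (P : FinPoset) (h : ℕ) (ht : Fin (FinPoset.size P) → Fin h) (ht-mono : StrictlyMonotone P h ht)
  {A : Set} (R : A → A → Set) (R-refl : Reflexive R) where

  open FinPoset P using (size; _≼_)

  -- `φ x` is the cell of `x`, and many points may share a cell. The four properties are chosen to
  -- survive both deleting points and merging cells; order is known only between cells that differ
  -- strictly in every coordinate.
  record Placement {d} (F : List A) (φ : A → Vec ℕ d) (s : Vec ℕ d) : Set where
    field
      unique  : Unique F
      noCopy  : ¬ ContainsWeakCopy P R F
      ordered : ∀ {x y} → x ∈ F → y ∈ F → φ x ≪ φ y → R x y
      bounded : ∀ {x} → x ∈ F → φ x ≪ s

  open Placement

  filter-placement : ∀ {d F} {φ : A → Vec ℕ d} {s} {Q : A → Set} (Q? : Decidable Q) →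
    Placement F φ s → Placement (filter Q? F) φ s
  filter-placement Q? p .unique      = Unique.filter⁺ Q? (unique p)
  filter-placement Q? p .noCopy      (π , inj , π∈ , mono) =
    noCopy p (π , inj , proj₁ ∘ ∈-filter⁻ Q? ∘ π∈ , mono)
  filter-placement Q? p .ordered x∈ y∈ = ordered p (proj₁ (∈-filter⁻ Q? x∈)) (proj₁ (∈-filter⁻ Q? y∈))
  filter-placement Q? p .bounded x∈ = bounded p (proj₁ (∈-filter⁻ Q? x∈))

  half-placement : ∀ {d F} {φ : A → Vec ℕ d} {s} → Placement F φ s → Placement F (half ∘ φ) (half↑ s)
  half-placement p .unique        = unique p
  half-placement p .noCopy        = noCopy p
  half-placement p .ordered x∈ y∈ = ordered p x∈ y∈ ∘ half-reflects-≪ _ _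
  half-placement p .bounded x∈    = half-≪ _ _ (bounded p x∈)

  module _ {d F} {φ : A → Vec ℕ (suc d)} {s} (pl : Placement F φ s) where

    rich? : Decidable (λ x → size ≤ fibre φ F (φ x))
    rich? x = size ≤? fibre φ F (φ x)

    rich poor : List A
    rich = filter rich? F
    poor = filter (¬? ∘ rich?) F

    module _ (b : Vec ℕ (suc d)) where

      hit? : Decidable (λ t → Any (λ x → φ x ≡ shift t b) rich)
      hit? t = Any.any? (λ x → φ x ≟ᵛ shift t b) rich

      hits : List ℕ
      hits = filter hit? (upTo (Vec.head s))

      -- With h rich cells on a line, P embeds: send x to the ht x-th of them, choosing distinct points in each cell.
      line-bound : length hits < h
      line-bound = ≰⇒> λ h≤ → noCopy pl (copy h≤)
        where
        module _ (h≤ : h ≤ length hits) where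
          τ : Fin h → ℕ
          τ i = Data.List.lookup hits (Fin.inject≤ i h≤)

          τ-mono : ∀ {i j} → i Fin.< j → τ i < τ j
          τ-mono {i} {j} i<j = lookup-< (AllPairs.filter⁺ hit? (AllPairs.applyUpTo⁺₁ id (Vec.head s) (λ i<j _ → i<j)))
            (subst₂ _<_ (sym (toℕ-inject≤ i h≤)) (sym (toℕ-inject≤ j h≤)) i<j)

          τ-injective : ∀ {i j} → τ i ≡ τ j → i ≡ j
          τ-injective eq = inject≤-injective h≤ h≤ _ _
            (lookup-injective (Unique.filter⁺ hit? (Unique.upTo⁺ (Vec.head s))) eq)

          cell : Fin h → List A
          cell i = filter (λ x → φ x ≟ᵛ shift (τ i) b) F

          size≤cell : ∀ i → size ≤ length (cell i)
          size≤cell i with find (proj₂ (∈-filter⁻ hit? {xs = upTo (Vec.head s)} (∈-lookup (Fin.inject≤ i h≤))))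
          ... | x , x∈ , φx≡ = subst (λ c → size ≤ fibre φ F c) φx≡ (proj₂ (∈-filter⁻ rich? {xs = F} x∈))

          choose : Fin h → Fin size → A
          choose i x = Data.List.lookup (cell i) (Fin.inject≤ x (size≤cell i))

          choose∈ : ∀ i x → choose i x ∈ F × φ (choose i x) ≡ shift (τ i) b
          choose∈ i x = ∈-filter⁻ (λ y → φ y ≟ᵛ shift (τ i) b) (∈-lookup (Fin.inject≤ x (size≤cell i)))

          choose-injective : ∀ i {x y} → choose i x ≡ choose i y → x ≡ y
          choose-injective i eq = inject≤-injective (size≤cell i) (size≤cell i) _ _
            (lookup-injective (Unique.filter⁺ (λ y → φ y ≟ᵛ shift (τ i) b) (unique pl)) eq)

          π : Fin size → A
          π x = choose (ht x) x

          π-injective : Injective _≡_ _≡_ π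
          π-injective {x} {y} eq = choose-injective (ht y) (trans (cong (λ i → choose i x) (sym same)) eq)
            where
            same : ht x ≡ ht y
            same = τ-injective (shift-injective b
              (trans (sym (proj₂ (choose∈ (ht x) x))) (trans (cong φ eq) (proj₂ (choose∈ (ht y) y)))))

          π-mono : ∀ x y → x ≼ y → R (π x) (π y)
          π-mono x y x≼y with x Fin.≟ y
          ... | yes refl = R-refl
          ... | no  x≢y  = ordered pl (proj₁ (choose∈ (ht x) x)) (proj₁ (choose∈ (ht y) y))
            (subst₂ _≪_ (sym (proj₂ (choose∈ (ht x) x))) (sym (proj₂ (choose∈ (ht y) y)))
              (shift-≪ b (τ-mono (ht-mono x≼y x≢y))))

          copy : ContainsWeakCopy P R F
          copy = π , π-injective , (λ x → proj₁ (choose∈ (ht x) x)) , π-mono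

    -- The lines from `starts s` cover the box, each has fewer than h rich cells by `line-bound`,
    -- and a cell has at most q points.
    rich-bound : ∀ q → (∀ c → fibre φ F c ≤ q) → length rich ≤ T s * (h * q)
    rich-bound q fib = ≤-trans
      (count-cover-const onLine? (starts s) rich (h * q)
        (λ x∈ → Any.map (λ { (t , t< , eq) → lose (∈-upTo⁺ t<) eq })
                  (∈-starts (bounded pl (proj₁ (∈-filter⁻ rich? {xs = F} x∈)))))
        line)
      (≤-reflexive (cong (_* (h * q)) (length-starts s)))
      where
      OnLine : Vec ℕ (suc d) → A → Set
      OnLine b x = Any (λ t → φ x ≡ shift t b) (upTo (Vec.head s))
      onLine? : ∀ b → Decidable (OnLine b)
      onLine? b x = Any.any? (λ t → φ x ≟ᵛ shift t b) (upTo (Vec.head s))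
      line : ∀ b → count (onLine? b) rich ≤ h * q
      line b = ≤-trans
        (count-cover-const (λ t x → φ x ≟ᵛ shift t b) (hits b) (filter (onLine? b) rich) q cov
          (λ t → ≤-trans (count-filter (λ x → φ x ≟ᵛ shift t b) (onLine? b) rich)
                 (≤-trans (count-filter (λ x → φ x ≟ᵛ shift t b) rich? F) (fib (shift t b)))))
        (*-monoˡ-≤ q (<⇒≤ (line-bound b)))
        where
        cov : ∀ {x} → x ∈ filter (onLine? b) rich → Any (λ t → φ x ≡ shift t b) (hits b)
        cov x∈ with ∈-filter⁻ (onLine? b) {xs = rich} x∈
        ... | x∈rich , on with find on
        ...   | t , t∈ , eq = lose (∈-filter⁺ (hit? b) t∈ (lose x∈rich eq)) eq

    -- If the cell contains a poor point at all, that point witnesses that the cell has fewer than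
    -- `size` points of `F`.
    poor-fibre : ∀ c → fibre φ poor c ≤ size
    poor-fibre c = go (filter (λ x → φ x ≟ᵛ c) poor) refl
      where
      go : ∀ zs → filter (λ x → φ x ≟ᵛ c) poor ≡ zs → length zs ≤ size
      go []       _  = z≤n
      go (z ∷ zs) eq with ∈-filter⁻ (λ x → φ x ≟ᵛ c) {xs = poor} (subst (z ∈_) (sym eq) (here refl))
      ... | z∈ , refl = subst (λ l → length l ≤ size) eq
        (≤-trans (count-filter (λ x → φ x ≟ᵛ φ z) (¬? ∘ rich?) F)
                 (≰⇒≥ (proj₂ (∈-filter⁻ (¬? ∘ rich?) {xs = F} z∈))))

    rich-poor : ∀ q → (∀ c → fibre φ F c ≤ q) → length F ≤ T s * (h * q) + length poor
    rich-poor q fib = ≤-trans (≤-reflexive (length-split rich? F)) (+-monoˡ-≤ _ (rich-bound q fib))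

  module _ (0<h : 0 < h) where

    -- Merge cells, count the rich points and recurse on the poor ones. A merged cell holds at most
    -- 2^(2+d) * `size` points, and the line count drops by 3/4 in each round, so the factor 4 =
    -- 1/(1 - 3/4) sums a geometric series. `J` only serves termination: `T` strictly decreases and
    -- stays positive.
    poor-bound : ∀ J {d F} {φ : A → Vec ℕ (2 + d)} {s} → Placement F φ s → Positive s →
      (∀ c → fibre φ F c ≤ size) → T (half↑ s) ≤ J →
      length F ≤ 4 * (T (half↑ s) * (h * (2 ^ (2 + d) * size)))
    poor-bound zero pl pos fib T≤J = ⊥-elim (<⇒≱ (T-positive (half↑-positive pos)) T≤J)
    poor-bound (suc J) {d} {F} {φ} {s} pl pos fib T≤J = begin
      length F                            ≤⟨ rich-poor pl′ _ (fibre-half φ F size fib) ⟩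
      T s′ * D + length (poor pl′)        ≤⟨ +-monoʳ-≤ (T s′ * D) rest ⟩
      T s′ * D + 3 * (T s′ * D)           ≡⟨⟩
      4 * (T s′ * D)                      ∎
      where
      open ≤-Reasoning
      s′ = half↑ s
      D = h * (2 ^ (2 + d) * size)
      pl′ = half-placement pl
      pos′ = half↑-positive pos
      ring : ∀ a b → 4 * (a * b) ≡ 4 * a * b
      ring = solve-∀
      rest : length (poor pl′) ≤ 3 * (T s′ * D)
      rest with VecAny.any? (2 ≤?_) s′
      ... | yes 2≤s′ = begin
        length (poor pl′)   ≤⟨ poor-bound J (filter-placement (¬? ∘ rich? pl′) pl′) pos′ (poor-fibre pl′)
                                 (s≤s⁻¹ (≤-trans T″<T′ T≤J)) ⟩
        4 * (T (half↑ s′) * D) ≡⟨ ring (T (half↑ s′)) D ⟩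
        4 * T (half↑ s′) * D   ≤⟨ *-monoˡ-≤ D 4T″≤3T′ ⟩
        3 * T s′ * D           ≡⟨ *-assoc 3 (T s′) D ⟩
        3 * (T s′ * D)         ∎
        where
        4T″≤3T′ : 4 * T (half↑ s′) ≤ 3 * T s′
        4T″≤3T′ = T-half pos′ 2≤s′
        T″<T′ : T (half↑ s′) < T s′
        T″<T′ = *-cancelˡ-< 4 _ _ (≤-<-trans 4T″≤3T′ (m<n+m (3 * T s′) (T-positive pos′)))
      -- All sides are 1, so a single cell is left, with at most `size` poor points.
      ... | no s′≤1 = begin
        length (poor pl′)           ≤⟨ count-cover-const (λ c x → half (φ x) ≟ᵛ c) (box s′) (poor pl′) size
                                         (λ x∈ → lose (∈-box (bounded (filter-placement (¬? ∘ rich? pl′) pl′) x∈)) refl)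
                                         (poor-fibre pl′) ⟩
        length (box s′) * size      ≡⟨ cong (_* size) (trans (length-box s′) (trans (cong Π (ones pos′ s′≤1)) (Π-ones (2 + d)))) ⟩
        1 * size                    ≤⟨ *-mono-≤ (m≤n*m 1 (T s′) {{>-nonZero (T-positive pos′)}}) size≤D ⟩
        T s′ * 1 * D                ≡⟨ cong (_* D) (*-identityʳ (T s′)) ⟩
        T s′ * D                    ≤⟨ m≤n*m (T s′ * D) 3 ⟩
        3 * (T s′ * D)              ∎
        where
        size≤D : size ≤ D
        size≤D = ≤-trans (m≤n*m size (2 ^ (2 + d)) {{m^n≢0 2 (2 + d)}}) (m≤n*m _ h {{>-nonZero 0<h}})

    box-bound : ∀ {d F} {φ : A → Vec ℕ d} {s} → Placement F φ s → (∀ c → fibre φ F c ≤ 1) → length F ≤ Π s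
    box-bound {F = F} {φ} {s} pl fib = ≤-trans
      (count-cover-const (λ c x → φ x ≟ᵛ c) (box s) F 1 (λ x∈ → lose (∈-box (bounded pl x∈)) refl) fib)
      (≤-reflexive (trans (*-identityʳ _) (length-box s)))

    grid-bound : ∀ {d F} {φ : A → Vec ℕ (2 + d)} {s} → Placement F φ s → Positive s →
      (∀ c → fibre φ F c ≤ 1) → size ≤ 2 ^ (2 + d) → length F ≤ 72 * (h * T s)
    grid-bound {d} {F} {φ} {s} pl pos fib size≤ with Π s ≤? 4 * T s
    -- Here ∑ 1/sᵢ ≥ 1/4 and `T-div` may fail, but the box itself has few enough points.
    ... | yes Π≤4T = begin
      length F        ≤⟨ box-bound pl fib ⟩
      Π s             ≤⟨ Π≤4T ⟩
      4 * T s         ≤⟨ *-mono-≤ (m≤m+n 4 68) (m≤n*m (T s) h {{>-nonZero 0<h}}) ⟩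
      72 * (h * T s)  ∎
      where open ≤-Reasoning
    ... | no Π≰4T = begin
      length F
        -- Cells of side 1 hold at most one point, so those of side 2 hold at most `E`, without the
        -- factor `size`. The decrease of `T` by one halving could not pay for that factor.
        ≤⟨ rich-poor pl′ (E * 1) (fibre-half φ F 1 fib) ⟩
      T s₁ * (h * (E * 1)) + length (poor pl′)
        ≤⟨ +-monoʳ-≤ (T s₁ * (h * (E * 1)))
             (poor-bound (T s₂) (filter-placement (¬? ∘ rich? pl′) pl′) (half↑-positive pos) (poor-fibre pl′) ≤-refl) ⟩
      T s₁ * (h * (E * 1)) + 4 * (T s₂ * (h * (E * size)))
        ≤⟨ +-monoʳ-≤ (T s₁ * (h * (E * 1))) (*-monoʳ-≤ 4 (*-monoʳ-≤ (T s₂) (*-monoʳ-≤ h (*-monoʳ-≤ E size≤)))) ⟩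
      T s₁ * (h * (E * 1)) + 4 * (T s₂ * (h * (E * E)))
        ≡⟨ regroup (T s₁) (T s₂) h E ⟩
      h * (E * T s₁ + 4 * (E * E * T s₂))
        -- `T-div` with e = 2 gives 8 and with e = 4 gives 16; the latter pays for both factors `E`.
        -- So 72 = 8 + 4 · 16.
        ≤⟨ *-monoʳ-≤ h (+-mono-≤ (T-div s 4T≤Π 0<Π 2 ⌈_/2⌉ 2⌈⌉) (*-monoʳ-≤ 4 quarter)) ⟩
      h * (8 * T s + 4 * (16 * T s))
        ≡⟨ collect h (T s) ⟩
      72 * (h * T s) ∎
      where
      open ≤-Reasoning
      E  = 2 ^ (2 + d)
      s₁ = half↑ s
      s₂ = half↑ s₁
      pl′ = half-placement pl
      4T≤Π : 4 * T s ≤ Π s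
      4T≤Π = <⇒≤ (≰⇒> Π≰4T)
      0<Π : 0 < Π s
      0<Π = ≤-<-trans z≤n (≰⇒> Π≰4T)
      2⌈⌉ : ∀ x → 2 * ⌈ x /2⌉ ≤ x + 3
      2⌈⌉ x = ≤-trans (2*⌈n/2⌉≤1+n x) (≤-trans (≤-reflexive (+-comm 1 x)) (+-monoʳ-≤ x (s≤s z≤n)))
      quarter : E * E * T s₂ ≤ 16 * T s
      quarter = begin
        E * E * T s₂ ≡⟨ cong₂ (λ a v → a * T v) (sym (^-distribʳ-* (2 + d) 2 2)) (sym (Vec.map-∘ ⌈_/2⌉ ⌈_/2⌉ s)) ⟩
        4 ^ (2 + d) * T (Vec.map (⌈_/2⌉ ∘ ⌈_/2⌉) s) ≤⟨ T-div s 4T≤Π 0<Π 4 (⌈_/2⌉ ∘ ⌈_/2⌉) 4*⌈⌈n/2⌉/2⌉≤n+3 ⟩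
        16 * T s ∎
      regroup : ∀ a b h e → a * (h * (e * 1)) + 4 * (b * (h * (e * e))) ≡ h * (e * a + 4 * (e * e * b))
      regroup = solve-∀
      collect : ∀ h t → h * (8 * t + 4 * (16 * t)) ≡ 72 * (h * t)
      collect = solve-∀

-- Heights

module _ (P : FinPoset) where
  open FinPoset P
  open IsPartialOrder isPartialOrder using () renaming (trans to ≼-trans; antisym to ≼-antisym)

  _≻_ : Fin size → Fin size → Set
  x ≻ y = y ≼ x × x ≢ y

  -- A strictly descending chain of v elements below `x`; the greatest such v is the height of `x`,
  -- counted from 0.
  Depth : Fin size → ℕ → Set
  Depth x v = Σ (List (Fin size)) λ xs → AllPairs _≻_ (x ∷ xs) × length xs ≡ v

  depth-suc : ∀ {x y v} → y ≼ x → y ≢ x → Depth y v → Depth x (suc v)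
  depth-suc y≼x y≢x (ys , (y≻ys ∷ ps) , refl) =
    _ , (((y≼x , y≢x ∘ sym) ∷ All.map below y≻ys) ∷ (y≻ys ∷ ps)) , refl
    where
    below : ∀ {z} → _ ≻ z → _ ≻ z
    below (z≼y , y≢z) = ≼-trans z≼y y≼x , λ { refl → y≢z (≼-antisym y≼x z≼y) }

  depth-bound : ∀ {h} → IsHeight _≼_ h → ∀ x {v} → Depth x v → v < h
  depth-bound (_ , max) x (xs , ps , refl) =
    max (x ∷ xs) (AllPairs.map proj₂ ps , AllPairs.map (inj₂ ∘ proj₁) ps)

  -- If `v` is not the maximum, a greater `t` satisfies `Q`. Restarting from `t` uses up one unit of
  -- the fuel `f`, and no value reaches `h`.
  ¬¬-maximum : ∀ (Q : ℕ → Set) {h} → (∀ {u} → Q u → u < h) → ∀ f v → h ≤ f + v → Q v →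
    ¬ ¬ Σ ℕ λ u → Q u × (∀ {t} → Q t → t ≤ u)
  ¬¬-maximum Q bnd zero    v h≤ q no-max = <⇒≱ (bnd q) h≤
  ¬¬-maximum Q bnd (suc f) v h≤ q no-max = no-max (v , q , λ {t} qt →
    case t ≤? v of λ where
      (yes t≤v) → t≤v
      (no  t≰v) → ⊥-elim (¬¬-maximum Q bnd f t
        (≤-trans h≤ (≤-trans (≤-reflexive (sym (+-suc f v))) (+-monoʳ-≤ f (≰⇒> t≰v)))) qt no-max))

  -- ≼ need not be decidable, so heights exist only up to double negation.
  ¬¬-height : ∀ {h} → IsHeight _≼_ h →
    ¬ ¬ Σ (Fin size → Fin h) (StrictlyMonotone P h)
  -- Double negation commutes with a quantifier over the finite type `Fin size`.
  ¬¬-height {h} isH = ¬¬-map build (sequence (RawMonad.rawApplicative ¬¬-Monad) λ x →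
    ¬¬-maximum (Depth x) (depth-bound isH x) h 0 (m≤m+n h 0) ([] , ([] ∷ []) , refl))
    where
    build : (∀ x → Σ ℕ λ u → Depth x u × (∀ {t} → Depth x t → t ≤ u)) →
      Σ (Fin size → Fin h) (StrictlyMonotone P h)
    build m = ht , λ {x} {y} x≼y x≢y → subst₂ _<_ (sym (toℕ-fromℕ< _)) (sym (toℕ-fromℕ< _))
        (proj₂ (proj₂ (m y)) (depth-suc x≼y x≢y (proj₁ (proj₂ (m x)))))
      where
      ht : Fin size → Fin h
      ht x = fromℕ< (depth-bound isH x (proj₁ (proj₂ (m x))))

-- Symmetric chain decompositions of {0,…,k-1}ᵐ

∑-zero : ∀ (xs : List X) → ∑ xs (λ _ → 0) ≡ 0
∑-zero xs = trans (∑-const xs 0) (*-zeroʳ (length xs))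

∑-swap : ∀ (xs : List X) (ys : List Y) (f : X → Y → ℕ) →
  (∑ xs λ x → ∑ ys λ y → f x y) ≡ (∑ ys λ y → ∑ xs λ x → f x y)
∑-swap []       ys f = sym (∑-zero ys)
∑-swap (x ∷ xs) ys f = trans (cong (∑ ys (f x) +_) (∑-swap xs ys f)) (sym (∑-+ ys (f x) _))

∑-concatMap : ∀ (g : X → List Y) xs (f : Y → ℕ) → ∑ (concatMap g xs) f ≡ ∑ xs λ x → ∑ (g x) f
∑-concatMap g []       f = refl
∑-concatMap g (x ∷ xs) f = trans (∑-++ (g x) (concatMap g xs) f) (cong (∑ (g x) f +_) (∑-concatMap g xs f))

∑-upTo-suc : ∀ n (f : ℕ → ℕ) → ∑ (upTo (suc n)) f ≡ ∑ (upTo n) f + f n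
∑-upTo-suc n f = begin
  ∑ (upTo (suc n)) f           ≡⟨ cong (λ l → ∑ l f) (sym (upTo-∷ʳ n)) ⟩
  ∑ (upTo n ++ n ∷ []) f       ≡⟨ ∑-++ (upTo n) (n ∷ []) f ⟩
  ∑ (upTo n) f + (f n + 0)     ≡⟨ cong (∑ (upTo n) f +_) (+-identityʳ (f n)) ⟩
  ∑ (upTo n) f + f n           ∎
  where open ≡-Reasoning

∑-upTo-+ : ∀ m n (f : ℕ → ℕ) → ∑ (upTo (m + n)) f ≡ ∑ (upTo m) f + ∑ (upTo n) (λ i → f (m + i))
∑-upTo-+ m zero    f = trans (cong (λ l → ∑ (upTo l) f) (+-identityʳ m)) (sym (+-identityʳ _))
∑-upTo-+ m (suc n) f = begin
  ∑ (upTo (m + suc n)) f                                      ≡⟨ cong (λ l → ∑ (upTo l) f) (+-suc m n) ⟩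
  ∑ (upTo (suc (m + n))) f                                    ≡⟨ ∑-upTo-suc (m + n) f ⟩
  ∑ (upTo (m + n)) f + f (m + n)                              ≡⟨ cong (_+ f (m + n)) (∑-upTo-+ m n f) ⟩
  ∑ (upTo m) f + ∑ (upTo n) (λ i → f (m + i)) + f (m + n)     ≡⟨ +-assoc (∑ (upTo m) f) _ _ ⟩
  ∑ (upTo m) f + (∑ (upTo n) (λ i → f (m + i)) + f (m + n))   ≡⟨ cong (∑ (upTo m) f +_) (sym (∑-upTo-suc n (λ i → f (m + i)))) ⟩
  ∑ (upTo m) f + ∑ (upTo (suc n)) (λ i → f (m + i))           ∎
  where open ≡-Reasoning

tuples : List X → ∀ n → List (Vec X n)
tuples xs zero    = [] ∷ []
tuples xs (suc n) = cartesianProductWith _∷_ xs (tuples xs n)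

∑-tuples-suc : ∀ (xs : List X) n (f : Vec X (suc n) → ℕ) →
  ∑ (tuples xs (suc n)) f ≡ ∑ xs λ x → ∑ (tuples xs n) λ v → f (x ∷ v)
∑-tuples-suc xs n f = ∑-cartesianProductWith _∷_ xs (tuples xs n) f

length-tuples : ∀ (xs : List X) n → length (tuples xs n) ≡ length xs ^ n
length-tuples xs zero    = refl
length-tuples xs (suc n) = trans (length-cartesianProductWith _∷_ xs (tuples xs n))
                                 (cong (length xs *_) (length-tuples xs n))

words : ℕ → ∀ m → List (Vec ℕ m)
words k = tuples (upTo k)

length-words : ∀ k m → length (words k m) ≡ k ^ m
length-words k m = trans (length-tuples (upTo k) m) (cong (_^ m) (length-upTo k))

rank : Vec ℕ m → ℕ
rank []      = 0
rank (x ∷ v) = x + rank v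

_≤ᵛ_ : Vec ℕ m → Vec ℕ m → Set
_≤ᵛ_ = Pointwise _≤_

≤ᵛ-refl : {v : Vec ℕ m} → v ≤ᵛ v
≤ᵛ-refl = Pointwise.refl ≤-refl

-- The symmetric chains of {0,…,K} × {c ∷ cs}: the first runs up the first factor, then along the chain.
climb : ℕ → ℕ → Vec ℕ m → List (Vec ℕ m) → List (Vec ℕ (suc m))
climb i zero    c cs = (i ∷ c) ∷ map (i ∷_) cs
climb i (suc r) c cs = (i ∷ c) ∷ climb (suc i) r c cs

-- The de Bruijn-Tengbergen-Kruyswijk decomposition of a product of two chains: peeling off the
-- outer hook leaves the rectangle of `cs` and one letter fewer.
hooks : List (Vec ℕ m) → ℕ → List (List (Vec ℕ (suc m)))
hooks []       K       = []
hooks (c ∷ cs) zero    = []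
hooks (c ∷ cs) (suc K) = climb 0 K c cs ∷ hooks cs K

chains : ℕ → ∀ m → List (List (Vec ℕ m))
chains k zero    = ([] ∷ []) ∷ []
chains k (suc m) = concatMap (λ Γ → hooks Γ k) (chains k m)

-- The letters below `i` are added on both sides, so that row sums start at 0 and the induction on
-- `r` merely moves one term across.
∑-climb : ∀ i r (c : Vec ℕ m) cs f →
  ∑ (upTo i) (λ j → f (j ∷ c)) + ∑ (climb i r c cs) f
    ≡ ∑ (upTo (suc (i + r))) (λ j → f (j ∷ c)) + ∑ cs (λ v → f (i + r ∷ v))
∑-climb i zero c cs f rewrite +-identityʳ i = begin
  ∑ (upTo i) f′ + (f (i ∷ c) + ∑ (map (i ∷_) cs) f)    ≡⟨ sym (+-assoc (∑ (upTo i) f′) _ _) ⟩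
  ∑ (upTo i) f′ + f (i ∷ c) + ∑ (map (i ∷_) cs) f      ≡⟨ cong₂ _+_ (sym (∑-upTo-suc i f′)) (∑-map (i ∷_) cs f) ⟩
  ∑ (upTo (suc i)) f′ + ∑ cs (λ v → f (i ∷ v))         ∎
  where
  open ≡-Reasoning
  f′ = λ j → f (j ∷ c)
∑-climb i (suc r) c cs f rewrite +-suc i r = begin
  ∑ (upTo i) f′ + (f (i ∷ c) + ∑ (climb (suc i) r c cs) f)   ≡⟨ sym (+-assoc (∑ (upTo i) f′) _ _) ⟩
  ∑ (upTo i) f′ + f (i ∷ c) + ∑ (climb (suc i) r c cs) f     ≡⟨ cong (_+ ∑ (climb (suc i) r c cs) f) (sym (∑-upTo-suc i f′)) ⟩
  ∑ (upTo (suc i)) f′ + ∑ (climb (suc i) r c cs) f           ≡⟨ ∑-climb (suc i) r c cs f ⟩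
  ∑ (upTo (suc (suc (i + r)))) f′ + ∑ cs (λ v → f (suc (i + r) ∷ v)) ∎
  where
  open ≡-Reasoning
  f′ = λ j → f (j ∷ c)

∑-hooks : ∀ (Γ : List (Vec ℕ m)) K f →
  ∑ (hooks Γ K) (λ H → ∑ H f) ≡ ∑ Γ λ c → ∑ (upTo K) λ j → f (j ∷ c)
∑-hooks []       K    f = refl
∑-hooks (c ∷ cs) zero f = sym (∑-zero cs)
∑-hooks (c ∷ cs) (suc K) f = begin
  ∑ (climb 0 K c cs) f + ∑ (hooks cs K) (λ H → ∑ H f)
    ≡⟨ cong₂ _+_ (∑-climb 0 K c cs f) (∑-hooks cs K f) ⟩
  ∑ (upTo (suc K)) (λ j → f (j ∷ c)) + ∑ cs (λ v → f (K ∷ v)) + ∑ cs (λ v → ∑ (upTo K) λ j → f (j ∷ v))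
    ≡⟨ +-assoc (∑ (upTo (suc K)) (λ j → f (j ∷ c))) _ _ ⟩
  ∑ (upTo (suc K)) (λ j → f (j ∷ c)) + (∑ cs (λ v → f (K ∷ v)) + ∑ cs (λ v → ∑ (upTo K) λ j → f (j ∷ v)))
    ≡⟨ cong (∑ (upTo (suc K)) (λ j → f (j ∷ c)) +_)
         (trans (+-comm (∑ cs (λ v → f (K ∷ v))) _)
         (trans (sym (∑-+ cs _ _)) (∑-cong cs λ v → sym (∑-upTo-suc K (λ j → f (j ∷ v)))))) ⟩
  ∑ (upTo (suc K)) (λ j → f (j ∷ c)) + ∑ cs (λ v → ∑ (upTo (suc K)) λ j → f (j ∷ v)) ∎
  where open ≡-Reasoning

-- The chains partition the words, expressed through all weighted sums instead of a permutation of
-- lists. Constant and indicator weights give the counts used later.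
∑-chains : ∀ k m f → ∑ (chains k m) (λ Γ → ∑ Γ f) ≡ ∑ (words k m) f
∑-chains k zero    f = +-identityʳ _
∑-chains k (suc m) f = begin
  ∑ (concatMap (λ Γ → hooks Γ k) (chains k m)) (λ H → ∑ H f)
    ≡⟨ ∑-concatMap (λ Γ → hooks Γ k) (chains k m) _ ⟩
  ∑ (chains k m) (λ Γ → ∑ (hooks Γ k) λ H → ∑ H f)
    ≡⟨ ∑-cong (chains k m) (λ Γ → ∑-hooks Γ k f) ⟩
  ∑ (chains k m) (λ Γ → ∑ Γ λ v → ∑ (upTo k) λ j → f (j ∷ v))
    ≡⟨ ∑-chains k m _ ⟩
  ∑ (words k m) (λ v → ∑ (upTo k) λ j → f (j ∷ v))
    ≡⟨ ∑-swap (words k m) (upTo k) (λ v j → f (j ∷ v)) ⟩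
  ∑ (upTo k) (λ j → ∑ (words k m) λ v → f (j ∷ v))
    ≡⟨ sym (∑-tuples-suc (upTo k) m f) ⟩
  ∑ (words k (suc m)) f ∎
  where open ≡-Reasoning

∈-climb-head : ∀ i r {j} (c : Vec ℕ m) cs → i ≤ j → j ≤ i + r → (j ∷ c) ∈ climb i r c cs
∈-climb-head i zero c cs i≤j j≤i+r = here (cong (_∷ c) (≤-antisym (≤-trans j≤i+r (≤-reflexive (+-identityʳ i))) i≤j))
∈-climb-head i (suc r) {j} c cs i≤j j≤i+r with i ≟ j
... | yes refl = here refl
... | no  i≢j  = there (∈-climb-head (suc i) r c cs (≤∧≢⇒< i≤j i≢j) (≤-trans j≤i+r (≤-reflexive (+-suc i r))))

∈-climb-tail : ∀ i r {v : Vec ℕ m} c cs → v ∈ cs → (i + r ∷ v) ∈ climb i r c cs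
∈-climb-tail i zero c cs v∈ rewrite +-identityʳ i = there (∈-map⁺ (i ∷_) v∈)
∈-climb-tail i (suc r) c cs v∈ rewrite +-suc i r = there (∈-climb-tail (suc i) r c cs v∈)

∈-hooks : ∀ {Γ : List (Vec ℕ m)} {v} {j K} → v ∈ Γ → j < K → Any ((j ∷ v) ∈_) (hooks Γ K)
∈-hooks {Γ = c ∷ cs} {j = j} {suc K} (here refl) j<K = here (∈-climb-head 0 K c cs z≤n (s≤s⁻¹ j<K))
∈-hooks {Γ = c ∷ cs} {j = j} {suc K} (there v∈) j<K with j ≟ K
... | yes refl = here (∈-climb-tail 0 K c cs v∈)
... | no  j≢K  = there (∈-hooks v∈ (≤∧≢⇒< (s≤s⁻¹ j<K) j≢K))

∈-chains : ∀ k {v : Vec ℕ m} → VecAll.All (_< k) v → Any (v ∈_) (chains k m)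
∈-chains k []         = here (here refl)
∈-chains k (x<k ∷ v<k) = Any.concat⁺ (Any.map⁺ (Any.map (λ v∈ → ∈-hooks v∈ x<k) (∈-chains k v<k)))

-- Ranks rise by exactly one. Each element is compared with all later ones, so sortedness can be
-- read off without transitivity.
data Saturated {m : ℕ} : ℕ → List (Vec ℕ m) → Set where
  []   : ∀ {b} → Saturated b []
  cons : ∀ {b c cs} → rank c ≡ b → All (c ≤ᵛ_) cs → Saturated (suc b) cs → Saturated b (c ∷ cs)

saturated-map : ∀ i {b} {cs : List (Vec ℕ m)} → Saturated b cs → Saturated (i + b) (map (i ∷_) cs)
saturated-map i []                       = []
saturated-map i {b} (cons {cs = cs} refl c≤cs sat) = cons refl (All.map⁺ (All.map (≤-refl ∷_) c≤cs))
  (subst (λ b → Saturated b (map (i ∷_) cs)) (+-suc i b) (saturated-map i sat))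

climb-above : ∀ {j} i r {c : Vec ℕ m} {cs} → j ≤ i → All (c ≤ᵛ_) cs → All ((j ∷ c) ≤ᵛ_) (climb i r c cs)
climb-above i zero    j≤i c≤cs = (j≤i ∷ ≤ᵛ-refl) ∷ All.map⁺ (All.map (j≤i ∷_) c≤cs)
climb-above i (suc r) j≤i c≤cs = (j≤i ∷ ≤ᵛ-refl) ∷ climb-above (suc i) r (m≤n⇒m≤1+n j≤i) c≤cs

saturated-climb : ∀ i r {b} {c : Vec ℕ m} {cs} → Saturated b (c ∷ cs) → Saturated (i + b) (climb i r c cs)
saturated-climb i zero    sat                       = saturated-map i sat
saturated-climb i (suc r) sat@(cons refl c≤cs _) =
  cons refl (climb-above (suc i) r (n≤1+n i) c≤cs) (saturated-climb (suc i) r sat)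

length-climb : ∀ i r (c : Vec ℕ m) cs → length (climb i r c cs) ≡ suc (r + length cs)
length-climb i zero    c cs = cong suc (length-map (i ∷_) cs)
length-climb i (suc r) c cs = cong suc (length-climb (suc i) r c cs)

-- Least rank b and greatest rank b + |Γ| - 1 add up to N.
Symmetric : ℕ → List (Vec ℕ m) → Set
Symmetric N Γ = Σ ℕ λ b → Saturated b Γ × b + b + length Γ ≡ suc N × 1 ≤ length Γ

-- After a hook is peeled off, b has grown by one while `length Γ` and `K` have each dropped by one.
-- So b + b + length Γ + K is invariant, and all hooks have the same centre.
symmetric-hooks : ∀ {b N} (Γ : List (Vec ℕ m)) K → Saturated b Γ → b + b + length Γ + K ≡ suc (suc N) →
  All (Symmetric N) (hooks Γ K)
symmetric-hooks []       K       sat eq = []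
symmetric-hooks (c ∷ cs) zero    sat eq = []
symmetric-hooks {b = b} {N} (c ∷ cs) (suc K) sat@(cons _ _ sat′) eq =
  (b , saturated-climb 0 K sat , trans (cong (b + b +_) (length-climb 0 K c cs)) (suc-injective (trans (ring b K (length cs)) eq)) ,
   ≤-trans (s≤s z≤n) (≤-reflexive (sym (length-climb 0 K c cs))))
  ∷ symmetric-hooks cs K sat′ (trans (ring′ b K (length cs)) eq)
  where
  ring : ∀ b K l → suc (b + b + suc (K + l)) ≡ b + b + suc l + suc K
  ring = solve-∀
  ring′ : ∀ b K l → suc b + suc b + l + K ≡ b + b + suc l + suc K
  ring′ = solve-∀

symmetric-chains : ∀ k m → All (Symmetric (m * k)) (chains (suc k) m)
symmetric-chains k zero    = (0 , cons refl [] [] , refl , ≤-refl) ∷ []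
symmetric-chains k (suc m) = All.concat⁺ (All.map⁺ (All.map
  (λ { {Γ} (b , sat , eq , _) → symmetric-hooks Γ (suc k) sat
         (trans (cong (_+ suc k) eq) (cong suc (trans (+-suc (m * k) k) (cong suc (+-comm (m * k) k))))) })
  (symmetric-chains k m)))

saturated-rank : ∀ {b} {Γ : List (Vec ℕ m)} r → Saturated b Γ → b ≤ r → r < b + length Γ → Any (λ c → rank c ≡ r) Γ
saturated-rank {b = b} r [] b≤r r< = ⊥-elim (<⇒≱ r< (≤-trans (≤-reflexive (+-identityʳ b)) b≤r))
saturated-rank {b = b} {c ∷ cs} r (cons refl _ sat) b≤r r< with rank c ≟ r
... | yes eq = here eq
... | no  b≢r = there (saturated-rank r sat (≤∧≢⇒< b≤r b≢r) (≤-trans r< (≤-reflexive (+-suc b (length cs)))))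

δ : ℕ → ℕ → ℕ
δ c x with x ≟ c
... | yes _ = 1
... | no _  = 0

δ-refl : ∀ c → δ c c ≡ 1
δ-refl c with c ≟ c
... | yes _  = refl
... | no c≢c = ⊥-elim (c≢c refl)

δ-≢ : ∀ {c x} → x ≢ c → δ c x ≡ 0
δ-≢ {c} {x} x≢c with x ≟ c
... | yes x≡c = ⊥-elim (x≢c x≡c)
... | no _    = refl

-- Symmetry and 1 ≤ |Γ| give b ≤ ⌊N/2⌋ < b + |Γ|, and a saturated chain takes every rank in that
-- range.
symmetric-middle : ∀ {N} {Γ : List (Vec ℕ m)} → Symmetric N Γ → 1 ≤ ∑ Γ (δ ⌊ N /2⌋ ∘ rank)
symmetric-middle {N = N} {Γ} (b , sat , eq , 1≤∣Γ∣) = go (saturated-rank ⌊ N /2⌋ sat b≤ <b)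
  where
  open ≤-Reasoning
  go : ∀ {Γ : List (Vec ℕ _)} → Any (λ c → rank c ≡ ⌊ N /2⌋) Γ → 1 ≤ ∑ Γ (δ ⌊ N /2⌋ ∘ rank)
  go (here p)  = ≤-trans (≤-reflexive (sym (trans (cong (δ ⌊ N /2⌋) p) (δ-refl _)))) (m≤m+n _ _)
  go (there p) = ≤-trans (go p) (m≤n+m _ _)
  b≤ : b ≤ ⌊ N /2⌋
  b≤ = ≤-trans (≤-reflexive (n≡⌊n+n/2⌋ b)) (⌊n/2⌋-mono (s≤s⁻¹ (begin
    suc (b + b)      ≡⟨ +-comm 1 (b + b) ⟩
    b + b + 1        ≤⟨ +-monoʳ-≤ (b + b) 1≤∣Γ∣ ⟩
    b + b + length Γ ≡⟨ eq ⟩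
    suc N            ∎)))
  <b : ⌊ N /2⌋ < b + length Γ
  <b = +-cancelˡ-≤ b _ _ (begin
    b + suc ⌊ N /2⌋         ≡⟨ +-suc b ⌊ N /2⌋ ⟩
    suc (b + ⌊ N /2⌋)       ≤⟨ s≤s (+-monoˡ-≤ _ (≤-trans b≤ (⌊n/2⌋≤⌈n/2⌉ N))) ⟩
    suc (⌈ N /2⌉ + ⌊ N /2⌋) ≡⟨ cong suc (trans (+-comm ⌈ N /2⌉ _) (⌊n/2⌋+⌈n/2⌉≡n N)) ⟩
    suc N                   ≡⟨ sym (trans (sym (+-assoc b b (length Γ))) eq) ⟩
    b + (b + length Γ)      ∎)

-- The number of chains

∑-words-2 : ∀ M (f : Vec ℕ (suc M) → ℕ) →
  ∑ (words 2 (suc M)) f ≡ ∑ (words 2 M) λ v → f (0 ∷ v) + f (1 ∷ v)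
∑-words-2 M f = begin
  ∑ (words 2 (suc M)) f                                        ≡⟨ ∑-tuples-suc (upTo 2) M f ⟩
  ∑ (words 2 M) (f ∘ (0 ∷_)) + (∑ (words 2 M) (f ∘ (1 ∷_)) + 0) ≡⟨ cong (∑ (words 2 M) (f ∘ (0 ∷_)) +_) (+-identityʳ _) ⟩
  ∑ (words 2 M) (f ∘ (0 ∷_)) + ∑ (words 2 M) (f ∘ (1 ∷_))       ≡⟨ sym (∑-+ (words 2 M) _ _) ⟩
  ∑ (words 2 M) (λ v → f (0 ∷ v) + f (1 ∷ v))                  ∎
  where open ≡-Reasoning

dot : Vec ℕ m → Vec ℕ m → ℕ
dot []      []      = 0
dot (e ∷ u) (b ∷ v) = b * e + dot u v

module _ (a a′ : ℕ) where

  private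
    k = a + a′

  -- Splitting {0,…,k-1} as {0,…,a-1} ∪ (a + {0,…,a′-1}) and as {0,…,a′-1} ∪ (a′ + {0,…,a-1}) pairs
  -- up its elements, twice, at distances a and a′.
  pairing : ∀ (f : ℕ → ℕ) → 2 * ∑ (upTo k) f
    ≡ ∑ (upTo a′) (λ y → f y + f (a + y)) + ∑ (upTo a) (λ y → f y + f (a′ + y))
  pairing f = begin
    2 * ∑ (upTo k) f
      ≡⟨ cong (∑ (upTo k) f +_) (+-identityʳ _) ⟩
    ∑ (upTo k) f + ∑ (upTo k) f
      ≡⟨ cong₂ _+_ (∑-upTo-+ a a′ f) (trans (cong (λ l → ∑ (upTo l) f) (+-comm a a′)) (∑-upTo-+ a′ a f)) ⟩
    (∑ (upTo a) f + ∑ (upTo a′) (λ y → f (a + y))) + (∑ (upTo a′) f + ∑ (upTo a) (λ y → f (a′ + y)))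
      ≡⟨ shuffle (∑ (upTo a) f) _ (∑ (upTo a′) f) _ ⟩
    (∑ (upTo a′) f + ∑ (upTo a′) (λ y → f (a + y))) + (∑ (upTo a) f + ∑ (upTo a) (λ y → f (a′ + y)))
      ≡⟨ sym (cong₂ _+_ (∑-+ (upTo a′) f _) (∑-+ (upTo a) f _)) ⟩
    ∑ (upTo a′) (λ y → f y + f (a + y)) + ∑ (upTo a) (λ y → f y + f (a′ + y)) ∎
    where
    open ≡-Reasoning
    shuffle : ∀ p q r s → p + q + (r + s) ≡ r + q + (p + s)
    shuffle = solve-∀

  -- The uniform distribution on words over k letters is a mixture of uniform distributions on
  -- combinatorial cubes with all steps a or a′, so a bound for the latter transfers.
  cube-mixture : ∀ M B (g : ℕ → ℕ) →
    (∀ {e : Vec ℕ M} → VecAll.All (a ⊓ a′ ≤_) e → ∀ z → ∑ (words 2 M) (λ b → g (z + dot e b)) ≤ B) →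
    ∀ z → 2 ^ M * ∑ (words k M) (λ v → g (z + rank v)) ≤ k ^ M * B
  cube-mixture zero    B g hyp z = *-monoʳ-≤ 1 (hyp [] z)
  cube-mixture (suc M) B g hyp z = begin
    2 * 2 ^ M * ∑ (words k (suc M)) (λ v → g (z + rank v))
      ≡⟨ cong (2 * 2 ^ M *_) (trans (∑-tuples-suc (upTo k) M _)
           (∑-cong (upTo k) λ j → ∑-cong (words k M) λ v → cong g (sym (+-assoc z j (rank v))))) ⟩
    2 * 2 ^ M * ∑ (upTo k) (λ j → G (z + j))
      ≡⟨ cong (_* ∑ (upTo k) (λ j → G (z + j))) (*-comm 2 (2 ^ M)) ⟩
    2 ^ M * 2 * ∑ (upTo k) (λ j → G (z + j))
      ≡⟨ *-assoc (2 ^ M) 2 _ ⟩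
    2 ^ M * (2 * ∑ (upTo k) (λ j → G (z + j)))
      ≡⟨ cong (2 ^ M *_) (pairing (λ j → G (z + j))) ⟩
    2 ^ M * (∑ (upTo a′) (λ y → G (z + y) + G (z + (a + y))) + ∑ (upTo a) (λ y → G (z + y) + G (z + (a′ + y))))
      ≡⟨ trans (*-distribˡ-+ (2 ^ M) _ _) (sym (cong₂ _+_ (∑-*ˡ (upTo a′) (2 ^ M) _) (∑-*ˡ (upTo a) (2 ^ M) _))) ⟩
    ∑ (upTo a′) (λ y → 2 ^ M * (G (z + y) + G (z + (a + y)))) + ∑ (upTo a) (λ y → 2 ^ M * (G (z + y) + G (z + (a′ + y))))
      ≤⟨ +-mono-≤ (∑-mono (upTo a′) λ {y} _ → pair a (m⊓n≤m a a′) y) (∑-mono (upTo a) λ {y} _ → pair a′ (m⊓n≤n a a′) y) ⟩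
    ∑ (upTo a′) (λ _ → k ^ M * B) + ∑ (upTo a) (λ _ → k ^ M * B)
      ≡⟨ cong₂ _+_ (∑-upTo-const a′) (∑-upTo-const a) ⟩
    a′ * (k ^ M * B) + a * (k ^ M * B)
      ≡⟨ collect a a′ (k ^ M) B ⟩
    k * k ^ M * B ∎
    where
    open ≤-Reasoning
    G : ℕ → ℕ
    G w = ∑ (words k M) λ v → g (w + rank v)
    ∑-upTo-const : ∀ n → ∑ (upTo n) (λ _ → k ^ M * B) ≡ n * (k ^ M * B)
    ∑-upTo-const n = trans (∑-const (upTo n) _) (cong (_* (k ^ M * B)) (length-upTo n))
    collect : ∀ a a′ p b → a′ * (p * b) + a * (p * b) ≡ (a + a′) * p * b
    collect = solve-∀
    pair : ∀ e → a ⊓ a′ ≤ e → ∀ y → 2 ^ M * (G (z + y) + G (z + (e + y))) ≤ k ^ M * B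
    pair e e≥ y = ≤-trans
      (≤-reflexive (cong (2 ^ M *_) (trans (sym (∑-+ (words k M) _ _))
        (∑-cong (words k M) λ v → cong (λ w → g (z + y + rank v) + g w) (move z e y (rank v))))))
      -- The step `e` is absorbed into the function: summing w ↦ g w + g (w + e) over a cube of
      -- dimension M is summing `g` over one of dimension suc M. Hence the induction is over all
      -- `g`.
      (cube-mixture M B (λ w → g w + g (w + e)) step (z + y))
      where
      move : ∀ z e y r → z + (e + y) + r ≡ z + y + r + e
      move = solve-∀
      move₀ : ∀ z e r → z + r ≡ z + (0 * e + r)
      move₀ = solve-∀
      move₁ : ∀ z e r → z + r + e ≡ z + (1 * e + r)
      move₁ = solve-∀
      step : ∀ {es : Vec ℕ M} → VecAll.All (a ⊓ a′ ≤_) es → ∀ z →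
        ∑ (words 2 M) (λ b → g (z + dot es b) + g (z + dot es b + e)) ≤ B
      step {es} es≥ z = ≤-trans (≤-reflexive (trans
        (∑-cong (words 2 M) λ b → cong₂ (λ p q → g p + g q) (move₀ z e (dot es b)) (move₁ z e (dot es b)))
        (sym (∑-words-2 M (λ b → g (z + dot (e ∷ es) b)))))) (hyp (e≥ ∷ es≥) z)

-- Summing out one letter j turns the layer of rank c into the window c - k < r ≤ c for the rank r
-- of the other letters, and `hits k c` is its indicator. A window this long is comparable to the
-- steps of the cubes.
hits : ℕ → ℕ → ℕ → ℕ
hits k c r = ∑ (upTo k) λ j → δ c (j + r)

hits-cases : ∀ k c r → hits k c r ≡ 0 ⊎ (hits k c r ≡ 1 × r ≤ c × c < r + k)
hits-cases zero    c r = inj₁ refl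
hits-cases (suc k) c r with ∑-upTo-suc k (λ j → δ c (j + r)) | hits-cases k c r | k + r ≟ c
... | eq | ih | yes refl = inj₂ (trans eq (cong₂ _+_ none (δ-refl (k + r))) , m≤n+m r k ,
                                 ≤-reflexive (trans (cong suc (+-comm k r)) (sym (+-suc r k))))
  where
  none : hits k (k + r) r ≡ 0
  none with hits-cases k (k + r) r
  ... | inj₁ p = p
  ... | inj₂ (_ , _ , lt) = ⊥-elim (<-irrefl refl (<-≤-trans lt (≤-reflexive (+-comm r k))))
... | eq | inj₁ p | no k+r≢c = inj₁ (trans eq (cong₂ _+_ p (δ-≢ k+r≢c)))
... | eq | inj₂ (p , r≤c , lt) | no k+r≢c =
  inj₂ (trans eq (cong₂ _+_ p (δ-≢ k+r≢c)) , r≤c , <-≤-trans lt (+-monoʳ-≤ r (n≤1+n k)))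

hits≤1 : ∀ k c r → hits k c r ≤ 1
hits≤1 k c r with hits-cases k c r
... | inj₁ p       = ≤-trans (≤-reflexive p) z≤n
... | inj₂ (p , _) = ≤-reflexive p

module _ (a k c : ℕ) where

  Gap : ℕ → ℕ → Set
  Gap x y = x + a ≤ y

  -- `t` bounds how many points can still lie at or below `c`: passing to the next point gains `a`,
  -- which lowers `t` by one.
  hits-beyond : ∀ t {ys} → AllPairs Gap ys → All (λ y → c < y + t * a) ys → ∑ ys (hits k c) ≤ t
  hits-beyond t       []            []        = z≤n
  hits-beyond zero    {y ∷ ys} (_ ∷ gs) (c<y ∷ c<) = +-mono-≤ (≤-reflexive miss) (hits-beyond zero gs c<)
    where
    miss : hits k c y ≡ 0
    miss with hits-cases k c y
    ... | inj₁ p             = p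
    ... | inj₂ (_ , y≤c , _) = ⊥-elim (<⇒≱ c<y (≤-trans (≤-reflexive (+-identityʳ y)) y≤c))
  hits-beyond (suc t) {y ∷ ys} (g ∷ gs) (c<y ∷ _) = +-mono-≤ (hits≤1 k c y) (hits-beyond t gs
    (All.map (λ y+a≤ → <-≤-trans c<y (≤-trans (≤-reflexive (sym (+-assoc y a (t * a)))) (+-monoˡ-≤ (t * a) y+a≤))) g))

  -- Once a point y is in the window, c < y + k ≤ y + 3a, which leaves room for three points at
  -- distance `a`.
  hits≤3 : k ≤ 3 * a → ∀ {ys} → AllPairs Gap ys → ∑ ys (hits k c) ≤ 3
  hits≤3 k≤3a [] = z≤n
  hits≤3 k≤3a {y ∷ ys} (g ∷ gs) with hits-cases k c y
  ... | inj₁ p = ≤-trans (≤-reflexive (cong (_+ ∑ ys (hits k c)) p)) (hits≤3 k≤3a gs)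
  ... | inj₂ (_ , _ , c<y+k) = hits-beyond 3 (g ∷ gs)
    (c<y+3a ∷ All.map (λ y+a≤ → <-≤-trans c<y+3a (+-monoˡ-≤ (3 * a) (≤-trans (m≤m+n y a) y+a≤))) g)
    where
    c<y+3a : c < y + 3 * a
    c<y+3a = <-≤-trans c<y+k (+-monoʳ-≤ y k≤3a)

dot-mono : ∀ {u v : Vec ℕ m} (e : Vec ℕ m) → u ≤ᵛ v → dot e u ≤ dot e v
dot-mono []      []        = z≤n
dot-mono (e ∷ es) (x≤y ∷ p) = +-mono-≤ (*-monoˡ-≤ e x≤y) (dot-mono es p)

-- Some coordinate grows by at least 1, contributing its step; the others do not shrink.
dot-gap : ∀ {a} {u v e : Vec ℕ m} → VecAll.All (a ≤_) e → u ≤ᵛ v → rank u < rank v → dot e u + a ≤ dot e v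
dot-gap {u = []} {[]} [] [] ()
dot-gap {a = a} {x ∷ u} {y ∷ v} {e ∷ es} (a≤e ∷ es≥) (x≤y ∷ u≤v) u<v with x ≟ y
... | yes refl = ≤-trans (≤-reflexive (+-assoc (x * e) (dot es u) a))
                         (+-monoʳ-≤ (x * e) (dot-gap es≥ u≤v (+-cancelˡ-< x _ _ u<v)))
... | no x≢y = begin
  x * e + dot es u + a   ≤⟨ +-mono-≤ (+-monoʳ-≤ (x * e) (dot-mono es u≤v)) a≤e ⟩
  x * e + dot es v + e   ≡⟨ ring x e (dot es v) ⟩
  suc x * e + dot es v   ≤⟨ +-monoˡ-≤ (dot es v) (*-monoˡ-≤ e (≤∧≢⇒< x≤y x≢y)) ⟩
  y * e + dot es v       ∎
  where
  open ≤-Reasoning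
  ring : ∀ x e d → x * e + d + e ≡ suc x * e + d
  ring = solve-∀

saturated-rank≥ : ∀ {b} {Γ : List (Vec ℕ m)} → Saturated b Γ → All (λ c → b ≤ rank c) Γ
saturated-rank≥ []                = []
saturated-rank≥ (cons refl _ sat) = ≤-refl ∷ All.map <⇒≤ (saturated-rank≥ sat)

saturated-sorted : ∀ {b} {Γ : List (Vec ℕ m)} → Saturated b Γ →
  AllPairs (λ u v → u ≤ᵛ v × rank u < rank v) Γ
saturated-sorted []                   = []
saturated-sorted (cons refl c≤cs sat) = All.zip (c≤cs , saturated-rank≥ sat) ∷ saturated-sorted sat

-- A Littlewood–Offord bound: each chain of the cube meets the window in at most three points.
cube-window : ∀ {a k M} c {e : Vec ℕ M} → k ≤ 3 * a → VecAll.All (a ≤_) e → ∀ z →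
  ∑ (words 2 M) (λ b → hits k c (z + dot e b)) ≤ 3 * length (chains 2 M)
cube-window {a} {k} {M} c {e} k≤3a e≥ z = begin
  ∑ (words 2 M) (λ b → hits k c (z + dot e b))           ≡⟨ sym (∑-chains 2 M _) ⟩
  ∑ (chains 2 M) (λ Γ → ∑ Γ λ b → hits k c (z + dot e b)) ≤⟨ ∑-mono (chains 2 M) perChain ⟩
  ∑ (chains 2 M) (λ _ → 3)                                ≡⟨ trans (∑-const (chains 2 M) 3) (*-comm (length (chains 2 M)) 3) ⟩
  3 * length (chains 2 M)                                 ∎
  where
  open ≤-Reasoning
  perChain : ∀ {Γ} → Γ ∈ chains 2 M → ∑ Γ (λ b → hits k c (z + dot e b)) ≤ 3
  perChain {Γ} Γ∈ with All.lookup (symmetric-chains 1 M) Γ∈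
  ... | _ , sat , _ = ≤-trans (≤-reflexive (sym (∑-map (λ b → z + dot e b) Γ (hits k c))))
    (hits≤3 a k c k≤3a (AllPairs.map⁺ (AllPairs.map
      (λ { (u≤v , u<v) → ≤-trans (≤-reflexive (+-assoc z _ a)) (+-monoʳ-≤ z (dot-gap e≥ u≤v u<v)) })
      (saturated-sorted sat))))

chains≤middle : ∀ k m → length (chains (suc k) m) ≤ ∑ (words (suc k) m) (δ ⌊ m * k /2⌋ ∘ rank)
chains≤middle k m = begin
  length (chains (suc k) m)                                        ≡⟨ length-∑ (chains (suc k) m) ⟩
  ∑ (chains (suc k) m) (λ _ → 1)                                   ≤⟨ ∑-mono (chains (suc k) m)
                                                                        (symmetric-middle ∘ All.lookup (symmetric-chains k m)) ⟩
  ∑ (chains (suc k) m) (λ Γ → ∑ Γ (δ ⌊ m * k /2⌋ ∘ rank))          ≡⟨ ∑-chains (suc k) m _ ⟩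
  ∑ (words (suc k) m) (δ ⌊ m * k /2⌋ ∘ rank)                       ∎
  where open ≤-Reasoning

-- The first letter is summed out, which leaves a window for the other M letters. `cube-mixture`
-- with steps ⌊k/2⌋ and ⌈k/2⌉ then reduces to `cube-window`.
layer-bound : ∀ k M c → 2 ≤ k →
  2 ^ M * ∑ (words k (suc M)) (δ c ∘ rank) ≤ k ^ M * (3 * length (chains 2 M))
layer-bound k M c 2≤k = begin
  2 ^ M * ∑ (words k (suc M)) (δ c ∘ rank)
    ≡⟨ cong (2 ^ M *_) (trans (∑-tuples-suc (upTo k) M _) (∑-swap (upTo k) (words k M) _)) ⟩
  2 ^ M * ∑ (words k M) (λ v → hits k c (rank v))
    ≡⟨ cong (λ l → 2 ^ M * ∑ (words l M) (λ v → hits k c (rank v))) (sym (⌊n/2⌋+⌈n/2⌉≡n k)) ⟩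
  2 ^ M * ∑ (words (a + a′) M) (λ v → hits k c (rank v))
    ≤⟨ cube-mixture a a′ M (3 * length (chains 2 M)) (hits k c) (cube-window c (k≤3a k 2≤k)) 0 ⟩
  (a + a′) ^ M * (3 * length (chains 2 M))
    ≡⟨ cong (λ l → l ^ M * (3 * length (chains 2 M))) (⌊n/2⌋+⌈n/2⌉≡n k) ⟩
  k ^ M * (3 * length (chains 2 M)) ∎
  where
  open ≤-Reasoning
  a  = ⌊ k /2⌋
  a′ = ⌈ k /2⌉
  -- Tight at n = 3, which is why the window is allowed three steps and not two.
  2≤⇒≤3⌊/2⌋ : ∀ n → 2 ≤ n → n ≤ 3 * ⌊ n /2⌋
  2≤⇒≤3⌊/2⌋ 1 (s≤s ())
  2≤⇒≤3⌊/2⌋ 2 _ = m≤m+n 2 1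
  2≤⇒≤3⌊/2⌋ 3 _ = ≤-refl
  2≤⇒≤3⌊/2⌋ (suc (suc n@(suc (suc _)))) _ =
    ≤-trans (+-mono-≤ (m≤m+n 2 1) (2≤⇒≤3⌊/2⌋ n (s≤s (s≤s z≤n)))) (≤-reflexive (sym (*-suc 3 ⌊ n /2⌋)))
  k≤3a : ∀ k → 2 ≤ k → k ≤ 3 * (⌊ k /2⌋ ⊓ ⌈ k /2⌉)
  k≤3a k 2≤k = ≤-trans (2≤⇒≤3⌊/2⌋ k 2≤k) (≤-reflexive (cong (3 *_) (sym (m≤n⇒m⊓n≡m (⌊n/2⌋≤⌈n/2⌉ k)))))

-- Layers of the binary cube and central binomial coefficients

∑-δ-words-2 : ∀ M c → ∑ (words 2 M) (δ c ∘ rank) ≡ M C c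
∑-δ-words-2 zero    zero    = refl
∑-δ-words-2 zero    (suc c) = refl
∑-δ-words-2 (suc M) zero    = trans (∑-words-2 M _) (trans (∑-+ (words 2 M) _ _)
  (trans (cong₂ _+_ (∑-δ-words-2 M 0) (∑-zero (words 2 M))) refl))
∑-δ-words-2 (suc M) (suc c) = begin
  ∑ (words 2 (suc M)) (δ (suc c) ∘ rank)
    ≡⟨ trans (∑-words-2 M _) (∑-+ (words 2 M) _ _) ⟩
  ∑ (words 2 M) (δ (suc c) ∘ rank) + ∑ (words 2 M) (δ (suc c) ∘ suc ∘ rank)
    ≡⟨ cong (∑ (words 2 M) (δ (suc c) ∘ rank) +_) (∑-cong (words 2 M) (δ-suc c ∘ rank)) ⟩
  ∑ (words 2 M) (δ (suc c) ∘ rank) + ∑ (words 2 M) (δ c ∘ rank)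
    ≡⟨ cong₂ _+_ (∑-δ-words-2 M (suc c)) (∑-δ-words-2 M c) ⟩
  M C suc c + M C c
    ≡⟨ +-comm (M C suc c) _ ⟩
  M C c + M C suc c
    ≡⟨ nCk+nC[k+1]≡[n+1]C[k+1] M c ⟩
  suc M C suc c ∎
  where
  open ≡-Reasoning
  δ-suc : ∀ c x → δ (suc c) (suc x) ≡ δ c x
  δ-suc c x with x ≟ c
  ... | yes refl = δ-refl (suc x)
  ... | no x≢c = δ-≢ (x≢c ∘ suc-injective)

absorption : ∀ n k → suc k * (suc n C suc k) ≡ suc n * (n C k)
absorption n zero = trans (+-identityʳ _) (trans (nC1≡n (suc n)) (sym (*-identityʳ (suc n))))
absorption zero (suc k) = trans (cong (suc (suc k) *_) (k>n⇒nCk≡0 (s≤s (s≤s (z≤n {k}))))) (trans (*-zeroʳ (suc (suc k))) refl)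
absorption (suc n) (suc k) = begin
  suc (suc k) * (suc (suc n) C suc (suc k))
    ≡⟨ cong (suc (suc k) *_) (sym (nCk+nC[k+1]≡[n+1]C[k+1] (suc n) (suc k))) ⟩
  suc (suc k) * (x + suc n C suc (suc k))
    ≡⟨ expand (suc k) x _ ⟩
  x + suc k * x + suc (suc k) * (suc n C suc (suc k))
    ≡⟨ cong₂ (λ p q → x + p + q) (absorption n k) (absorption n (suc k)) ⟩
  x + suc n * (n C k) + suc n * (n C suc k)
    ≡⟨ collect x (suc n) (n C k) (n C suc k) ⟩
  x + suc n * (n C k + n C suc k)
    ≡⟨ cong (λ p → x + suc n * p) (nCk+nC[k+1]≡[n+1]C[k+1] n k) ⟩
  suc (suc n) * x ∎
  where
  open ≡-Reasoning
  x = suc n C suc k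
  expand : ∀ k x y → suc k * (x + y) ≡ x + k * x + suc k * y
  expand = solve-∀
  collect : ∀ x n p q → x + n * p + n * q ≡ x + n * (p + q)
  collect = solve-∀

module _ (j : ℕ) where
  central odd-central : ℕ
  central     = (j + j) C j
  odd-central = suc (j + j) C j

odd-central-symmetric : ∀ j → odd-central j ≡ suc (j + j) C suc j
odd-central-symmetric j = trans (nCk≡nC[n∸k] {j} {suc (j + j)} (m≤n⇒m≤1+n (m≤m+n j j)))
  (cong (suc (j + j) C_) (trans (+-∸-assoc 1 (m≤m+n j j)) (cong suc (m+n∸m≡n j j))))

odd-central-rec : ∀ j → suc j * odd-central j ≡ suc (j + j) * central j
odd-central-rec j = trans (cong (suc j *_) (odd-central-symmetric j)) (absorption (j + j) j)

central-suc : ∀ j → central (suc j) ≡ 2 * odd-central j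
central-suc j = begin
  suc (j + suc j) C suc j                   ≡⟨ cong (λ n → suc n C suc j) (+-suc j j) ⟩
  suc (suc (j + j)) C suc j                 ≡⟨ sym (nCk+nC[k+1]≡[n+1]C[k+1] (suc (j + j)) j) ⟩
  odd-central j + suc (j + j) C suc j       ≡⟨ cong (odd-central j +_) (trans (sym (odd-central-symmetric j)) (sym (+-identityʳ _))) ⟩
  2 * odd-central j                         ∎
  where open ≡-Reasoning

central-rec : ∀ j → suc j * central (suc j) ≡ 2 * (suc (j + j) * central j)
central-rec j = begin
  suc j * central (suc j)       ≡⟨ cong (suc j *_) (central-suc j) ⟩
  suc j * (2 * odd-central j)   ≡⟨ ring (suc j) (odd-central j) ⟩
  2 * (suc j * odd-central j)   ≡⟨ cong (2 *_) (odd-central-rec j) ⟩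
  2 * (suc (j + j) * central j) ∎
  where
  open ≡-Reasoning
  ring : ∀ a b → a * (2 * b) ≡ 2 * (a * b)
  ring = solve-∀

-- Consecutive left sides have ratio 4(2j+1)(2j+3)/(j+1)², which is below 16 since (2j+1)(2j+3) =
-- 4(j+1)² - 1.
central-upper : ∀ j → central j * central j * suc (j + j) ≤ 16 ^ j
central-upper zero    = ≤-refl
central-upper (suc j) = *-cancelˡ-≤ (suc j * suc j) (begin
  suc j * suc j * (c′ * c′ * suc (suc j + suc j))
    ≡⟨ regroup (suc j) c′ (suc (suc j + suc j)) ⟩
  suc j * c′ * (suc j * c′) * suc (suc j + suc j)
    ≡⟨ cong (λ p → p * p * suc (suc j + suc j)) (central-rec j) ⟩
  2 * (suc (j + j) * c) * (2 * (suc (j + j) * c)) * suc (suc j + suc j)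
    ≤⟨ m≤m+n _ (4 * (c * c * suc (j + j))) ⟩
  2 * (suc (j + j) * c) * (2 * (suc (j + j) * c)) * suc (suc j + suc j) + 4 * (c * c * suc (j + j))
    ≡⟨ square j c ⟩
  suc j * suc j * (16 * (c * c * suc (j + j)))
    ≤⟨ *-monoʳ-≤ (suc j * suc j) (*-monoʳ-≤ 16 (central-upper j)) ⟩
  suc j * suc j * (16 * 16 ^ j) ∎)
  where
  open ≤-Reasoning
  c  = central j
  c′ = central (suc j)
  regroup : ∀ a b n → a * a * (b * b * n) ≡ a * b * (a * b) * n
  regroup = solve-∀
  square : ∀ j c → 2 * (suc (j + j) * c) * (2 * (suc (j + j) * c)) * suc (suc j + suc j) + 4 * (c * c * suc (j + j))
    ≡ suc j * suc j * (16 * (c * c * suc (j + j)))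
  square = solve-∀

-- With n = j + 1, consecutive right sides have ratio 4(2n+1)²/(n(n+1)), which exceeds 16 since
-- (2n+1)² = 4n(n+1) + 1. Equality holds at j = 0.
central-lower : ∀ j → 16 ^ suc j ≤ 4 * suc j * (central (suc j) * central (suc j))
central-lower zero    = ≤-refl
central-lower (suc j) = *-cancelˡ-≤ (n * n) (begin
  n * n * (16 * 16 ^ suc j)
    ≤⟨ *-monoʳ-≤ (n * n) (*-monoʳ-≤ 16 (central-lower j)) ⟩
  n * n * (16 * (4 * suc j * (c * c)))
    ≤⟨ m≤m+n _ (16 * n * (c * c)) ⟩
  n * n * (16 * (4 * suc j * (c * c))) + 16 * n * (c * c)
    ≡⟨ square j c ⟩
  4 * n * (2 * (suc (suc j + suc j) * c) * (2 * (suc (suc j + suc j) * c)))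
    ≡⟨ cong (λ p → 4 * n * (p * p)) (sym (central-rec (suc j))) ⟩
  4 * n * (n * c′ * (n * c′))
    ≡⟨ regroup n c′ ⟩
  n * n * (4 * n * (c′ * c′)) ∎)
  where
  open ≤-Reasoning
  n  = suc (suc j)
  c  = central (suc j)
  c′ = central (suc (suc j))
  regroup : ∀ a b → 4 * a * (a * b * (a * b)) ≡ a * a * (4 * a * (b * b))
  regroup = solve-∀
  square : ∀ j c → suc (suc j) * suc (suc j) * (16 * (4 * suc j * (c * c))) + 16 * suc (suc j) * (c * c)
    ≡ 4 * suc (suc j) * (2 * (suc (suc j + suc j) * c) * (2 * (suc (suc j + suc j) * c)))
  square = solve-∀

4^[j+j] : ∀ j → 4 ^ (j + j) ≡ 16 ^ j
4^[j+j] j = trans (^-distribˡ-+-* 4 j j) (sym (^-distribʳ-* j 4 4))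

even-or-odd : ∀ n → Σ ℕ λ j → n ≡ j + j ⊎ n ≡ suc (j + j)
even-or-odd zero = 0 , inj₁ refl
even-or-odd (suc n) with even-or-odd n
... | j , inj₁ refl = j , inj₂ refl
... | j , inj₂ refl = suc j , inj₁ (cong suc (sym (+-suc j j)))

middle : ℕ → ℕ
middle n = n C ⌊ n /2⌋

middle-even : ∀ j → middle (j + j) ≡ central j
middle-even j = cong ((j + j) C_) (sym (n≡⌊n+n/2⌋ j))

middle-odd : ∀ j → middle (suc (j + j)) ≡ odd-central j
middle-odd j = cong (suc (j + j) C_) (sym (n≡⌈n+n/2⌉ j))

-- The odd case follows from the next even one, as `odd-central j` is half of `central (suc j)`.
middle-upper : ∀ n → middle n * middle n * suc n ≤ 4 ^ n
middle-upper n with even-or-odd n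
... | j , inj₁ refl = ≤-trans (≤-reflexive (cong (λ b → b * b * suc (j + j)) (middle-even j)))
                              (≤-trans (central-upper j) (≤-reflexive (sym (4^[j+j] j))))
... | j , inj₂ refl = *-cancelˡ-≤ 4 (begin
  4 * (middle (suc (j + j)) * middle (suc (j + j)) * suc (suc (j + j)))
    ≡⟨ cong (λ b → 4 * (b * b * suc (suc (j + j)))) (middle-odd j) ⟩
  4 * (o * o * suc (suc (j + j)))
    ≤⟨ *-monoʳ-≤ 4 (*-monoʳ-≤ (o * o) (≤-trans (n≤1+n _) (≤-reflexive (cong (2 +_) (sym (+-suc j j)))))) ⟩
  4 * (o * o * suc (suc j + suc j))
    ≡⟨ regroup o (suc (suc j + suc j)) ⟩
  2 * o * (2 * o) * suc (suc j + suc j)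
    ≡⟨ cong (λ b → b * b * suc (suc j + suc j)) (sym (central-suc j)) ⟩
  central (suc j) * central (suc j) * suc (suc j + suc j)
    ≤⟨ central-upper (suc j) ⟩
  16 * 16 ^ j
    ≡⟨ trans (*-assoc 4 4 (16 ^ j)) (cong (λ p → 4 * (4 * p)) (sym (4^[j+j] j))) ⟩
  4 * (4 * 4 ^ (j + j)) ∎)
  where
  open ≤-Reasoning
  o = odd-central j
  regroup : ∀ o n → 4 * (o * o * n) ≡ 2 * o * (2 * o) * n
  regroup = solve-∀

middle-lower : ∀ n → 4 ^ n ≤ 2 * suc n * (middle n * middle n)
middle-lower n with even-or-odd n
... | zero  , inj₁ refl = m≤m+n 1 1
... | suc j , inj₁ refl = begin
  4 ^ (suc j + suc j)                        ≡⟨ 4^[j+j] (suc j) ⟩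
  16 ^ suc j                                 ≤⟨ central-lower j ⟩
  4 * suc j * (c * c)                        ≤⟨ *-monoˡ-≤ (c * c) (≤-trans (m≤m+n (4 * suc j) 2) (≤-reflexive (ring j))) ⟩
  2 * suc (suc j + suc j) * (c * c)          ≡⟨ cong (λ b → 2 * suc (suc j + suc j) * (b * b)) (sym (middle-even (suc j))) ⟩
  2 * suc (suc j + suc j) * (middle (suc j + suc j) * middle (suc j + suc j)) ∎
  where
  open ≤-Reasoning
  c = central (suc j)
  ring : ∀ j → 4 * suc j + 2 ≡ 2 * suc (suc j + suc j)
  ring = solve-∀
... | j , inj₂ refl = *-cancelˡ-≤ 4 (begin
  4 * (4 * 4 ^ (j + j))
    ≡⟨ sym (trans (*-assoc 4 4 (16 ^ j)) (cong (λ p → 4 * (4 * p)) (sym (4^[j+j] j)))) ⟩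
  16 ^ suc j
    ≤⟨ central-lower j ⟩
  4 * suc j * (central (suc j) * central (suc j))
    ≡⟨ cong (λ b → 4 * suc j * (b * b)) (central-suc j) ⟩
  4 * suc j * (2 * o * (2 * o))
    ≡⟨ regroup j o ⟩
  4 * (2 * suc (suc (j + j)) * (o * o))
    ≡⟨ cong (λ b → 4 * (2 * suc (suc (j + j)) * (b * b))) (sym (middle-odd j)) ⟩
  4 * (2 * suc (suc (j + j)) * (middle (suc (j + j)) * middle (suc (j + j)))) ∎)
  where
  open ≤-Reasoning
  o = odd-central j
  regroup : ∀ j o → 4 * suc j * (2 * o * (2 * o)) ≡ 4 * (2 * suc (suc (j + j)) * (o * o))
  regroup = solve-∀

chains-2≤middle : ∀ M → length (chains 2 M) ≤ middle M
chains-2≤middle M = ≤-trans (chains≤middle 1 M)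
  (≤-reflexive (trans (∑-δ-words-2 M _) (cong (λ n → M C ⌊ n /2⌋) (*-identityʳ M))))

-- W ≤ 3 k^(m-1)/√m, squared. The 3 is that of `cube-window`, and √m comes from the middle binomial
-- coefficient of m - 1.
chains-bound : ∀ k m → 2 ≤ k → 1 ≤ m → length (chains k m) ^ 2 * (m * k ^ 2) ≤ 9 * (k ^ m) ^ 2
chains-bound k@(suc k′) (suc M) 2≤k _ = *-cancelˡ-≤ (4 ^ M) {{m^n≢0 4 M}} (begin
  4 ^ M * (W ^ 2 * (suc M * k ^ 2))
    ≡⟨ trans (cong (_* (W ^ 2 * (suc M * k ^ 2))) (^-distribʳ-* M 2 2)) (square₁ (2 ^ M) W (suc M) k) ⟩
  (2 ^ M * W) ^ 2 * (suc M * k ^ 2)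
    ≤⟨ *-monoˡ-≤ (suc M * k ^ 2) (^-monoˡ-≤ 2 (begin
         2 ^ M * W                                                      ≤⟨ *-monoʳ-≤ (2 ^ M) (chains≤middle k′ (suc M)) ⟩
         2 ^ M * ∑ (words k (suc M)) (δ ⌊ suc M * k′ /2⌋ ∘ rank)        ≤⟨ layer-bound k M _ 2≤k ⟩
         k ^ M * (3 * length (chains 2 M))                              ≤⟨ *-monoʳ-≤ (k ^ M) (*-monoʳ-≤ 3 (chains-2≤middle M)) ⟩
         k ^ M * (3 * b)                                                ∎)) ⟩
  (k ^ M * (3 * b)) ^ 2 * (suc M * k ^ 2)
    ≡⟨ square₂ (k ^ M) b (suc M) k ⟩
  9 * (k * k ^ M) ^ 2 * (b * b * suc M)
    ≤⟨ *-monoʳ-≤ (9 * (k * k ^ M) ^ 2) (middle-upper M) ⟩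
  9 * (k * k ^ M) ^ 2 * 4 ^ M
    ≡⟨ *-comm (9 * (k * k ^ M) ^ 2) (4 ^ M) ⟩
  4 ^ M * (9 * (k * k ^ M) ^ 2) ∎)
  where
  open ≤-Reasoning
  W = length (chains k (suc M))
  b = middle M
  square₁ : ∀ e w n k → e * e * (w * (w * 1) * (n * (k * (k * 1)))) ≡ e * w * (e * w * 1) * (n * (k * (k * 1)))
  square₁ = solve-∀
  square₂ : ∀ p b n k → p * (3 * b) * (p * (3 * b) * 1) * (n * (k * (k * 1))) ≡ 9 * (k * p * (k * p * 1)) * (b * b * n)
  square₂ = solve-∀

-- From grids to the whole cube

∑-*ʳ : ∀ (xs : List X) (f : X → ℕ) c → ∑ xs (λ x → f x * c) ≡ ∑ xs f * c
∑-*ʳ []       f c = refl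
∑-*ʳ (x ∷ xs) f c = trans (cong (f x * c +_) (∑-*ʳ xs f c)) (sym (*-distribʳ-+ c (f x) (∑ xs f)))

sizes : ∀ {d} → Vec (List X) d → Vec ℕ d
sizes = Vec.map length

module _ (xs : List (List X)) where
  private
    M = ∑ xs length

  ∑-Π-tuples : ∀ d → ∑ (tuples xs d) (Π ∘ sizes) ≡ M ^ d
  ∑-Π-tuples zero    = refl
  ∑-Π-tuples (suc d) = begin
    ∑ (tuples xs (suc d)) (Π ∘ sizes)                          ≡⟨ ∑-tuples-suc xs d _ ⟩
    (∑ xs λ x → ∑ (tuples xs d) λ g → length x * Π (sizes g))  ≡⟨ ∑-cong xs (λ x → trans (∑-*ˡ (tuples xs d) (length x) _)
                                                                    (cong (length x *_) (∑-Π-tuples d))) ⟩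
    ∑ xs (λ x → length x * M ^ d)                              ≡⟨ ∑-*ʳ xs length (M ^ d) ⟩
    M * M ^ d                                                  ∎
    where open ≡-Reasoning

  -- In each of the d terms of `T` one list is free, giving `length xs`, and each of the others sums
  -- to `M`. The factor `M` on the left avoids the exponent d - 1.
  ∑-T-tuples : ∀ d → M * ∑ (tuples xs d) (T ∘ sizes) ≡ d * (length xs * M ^ d)
  ∑-T-tuples zero    = *-zeroʳ M
  ∑-T-tuples (suc d) = begin
    M * ∑ (tuples xs (suc d)) (T ∘ sizes)
      ≡⟨ cong (M *_) (∑-tuples-suc xs d _) ⟩
    M * (∑ xs λ x → ∑ (tuples xs d) λ g → Π (sizes g) + length x * T (sizes g))
      ≡⟨ cong (M *_) (∑-cong xs λ x → trans (∑-+ (tuples xs d) _ _)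
           (cong₂ _+_ (∑-Π-tuples d) (∑-*ˡ (tuples xs d) (length x) _))) ⟩
    M * ∑ xs (λ x → M ^ d + length x * τ)
      ≡⟨ cong (M *_) (trans (∑-+ xs _ _) (cong₂ _+_ (∑-const xs (M ^ d)) (∑-*ʳ xs length τ))) ⟩
    M * (length xs * M ^ d + M * τ)
      ≡⟨ cong (λ t → M * (length xs * M ^ d + t)) (∑-T-tuples d) ⟩
    M * (length xs * M ^ d + d * (length xs * M ^ d))
      ≡⟨ ring M (length xs) (M ^ d) d ⟩
    suc d * (length xs * (M * M ^ d)) ∎
    where
    open ≡-Reasoning
    τ = ∑ (tuples xs d) (T ∘ sizes)
    ring : ∀ a l p d → a * (l * p + d * (l * p)) ≡ suc d * (l * (a * p))
    ring = solve-∀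

∈-tuples : ∀ {d} {P : X → Y → Set} {us : Vec X d} {ys : List Y} →
  VecAll.All (λ u → Any (P u) ys) us → Any (Pointwise P us) (tuples ys d)
∈-tuples []         = here []
∈-tuples (any ∷ us) with find any | find (∈-tuples us)
... | y , y∈ , p | g , g∈ , ps = lose (∈-cartesianProductWith⁺ _∷_ y∈ g∈) (p ∷ ps)

∈-tuples⁻ : ∀ {d} {ys : List Y} {g : Vec Y d} → g ∈ tuples ys d → VecAll.All (_∈ ys) g
∈-tuples⁻ {d = zero}           (here refl) = []
∈-tuples⁻ {d = suc d} {ys} g∈ with ∈-cartesianProductWith⁻ _∷_ ys (tuples ys d) g∈
... | _ , _ , y∈ , g′∈ , refl = y∈ ∷ ∈-tuples⁻ g′∈

∈-words : ∀ {k} {v : Vec ℕ m} → VecAll.All (_< k) v → v ∈ words k m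
∈-words []          = here refl
∈-words (x<k ∷ v<k) = ∈-cartesianProductWith⁺ _∷_ (∈-upTo⁺ x<k) (∈-words v<k)

pos : Vec ℕ m → List (Vec ℕ m) → ℕ
pos v []      = 0
pos v (u ∷ Γ) with v ≟ᵛ u
... | yes _ = 0
... | no _  = suc (pos v Γ)

pos-bounded : ∀ {v : Vec ℕ m} {Γ} → v ∈ Γ → pos v Γ < length Γ
pos-bounded {v = v} {u ∷ Γ} v∈ with v ≟ᵛ u | v∈
... | yes _  | _         = s≤s z≤n
... | no v≢u | here v≡u  = ⊥-elim (v≢u v≡u)
... | no _   | there v∈Γ = s≤s (pos-bounded v∈Γ)

pos-injective : ∀ {u v : Vec ℕ m} {Γ} → u ∈ Γ → v ∈ Γ → pos u Γ ≡ pos v Γ → u ≡ v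
pos-injective {u = u} {v} {w ∷ Γ} u∈ v∈ eq with u ≟ᵛ w | v ≟ᵛ w | u∈ | v∈
... | yes refl | yes refl | _ | _ = refl
... | no u≢w | no v≢w | here u≡w | _ = ⊥-elim (u≢w u≡w)
... | no u≢w | no v≢w | there _ | here v≡w = ⊥-elim (v≢w v≡w)
... | no _ | no _ | there u∈Γ | there v∈Γ = pos-injective u∈Γ v∈Γ (suc-injective eq)
pos-injective {Γ = _ ∷ _} _ _ () | yes _ | no _ | _ | _
pos-injective {Γ = _ ∷ _} _ _ () | no _ | yes _ | _ | _

pos-ordered : ∀ {u v : Vec ℕ m} {Γ} → AllPairs _≤ᵛ_ Γ → u ∈ Γ → v ∈ Γ → pos u Γ < pos v Γ → u ≤ᵛ v
pos-ordered {u = u} {v} {w ∷ Γ} (w≤ ∷ ps) u∈ v∈ lt with u ≟ᵛ w | v ≟ᵛ w | u∈ | v∈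
... | yes refl | no v≢w | _ | here v≡w  = ⊥-elim (v≢w v≡w)
... | yes refl | no _   | _ | there v∈Γ = All.lookup w≤ v∈Γ
... | no u≢w | no v≢w | here u≡w | _ = ⊥-elim (u≢w u≡w)
... | no u≢w | no v≢w | there _ | here v≡w = ⊥-elim (v≢w v≡w)
... | no _ | no _ | there u∈Γ | there v∈Γ = pos-ordered ps u∈Γ v∈Γ (s≤s⁻¹ lt)
pos-ordered {Γ = _ ∷ _} _ _ _ () | yes _ | yes _ | _ | _
pos-ordered {Γ = _ ∷ _} _ _ _ () | no _ | yes _ | _ | _

positions : ∀ {d} → Vec (Vec ℕ m) d → Vec (List (Vec ℕ m)) d → Vec ℕ d
positions = Vec.zipWith pos

_∈ᵛ_ : ∀ {d} → Vec (Vec ℕ m) d → Vec (List (Vec ℕ m)) d → Set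
_∈ᵛ_ = Pointwise _∈_

positions-bounded : ∀ {d} {us : Vec (Vec ℕ m) d} {g} → us ∈ᵛ g → positions us g ≪ sizes g
positions-bounded []        = []
positions-bounded (u∈ ∷ us) = pos-bounded u∈ ∷ positions-bounded us

positions-injective : ∀ {d} {us vs : Vec (Vec ℕ m) d} {g} → us ∈ᵛ g → vs ∈ᵛ g →
  positions us g ≡ positions vs g → us ≡ vs
positions-injective []        []        eq = refl
positions-injective (u∈ ∷ us) (v∈ ∷ vs) eq =
  cong₂ _∷_ (pos-injective u∈ v∈ (Vec.∷-injectiveˡ eq)) (positions-injective us vs (Vec.∷-injectiveʳ eq))

positions-ordered : ∀ {d} {us vs : Vec (Vec ℕ m) d} {g} → VecAll.All (AllPairs _≤ᵛ_) g →
  us ∈ᵛ g → vs ∈ᵛ g → positions us g ≪ positions vs g → Pointwise _≤ᵛ_ us vs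
positions-ordered []       []        []        []        = []
positions-ordered (o ∷ os) (u∈ ∷ us) (v∈ ∷ vs) (lt ∷ ≪) = pos-ordered o u∈ v∈ lt ∷ positions-ordered os us vs ≪

module Blocks (r d m : ℕ) where

  prefix : Vec ℕ (r + d * m) → Vec ℕ r
  prefix = Vec.take r

  blocks : Vec ℕ (r + d * m) → Vec (Vec ℕ m) d
  blocks v = proj₁ (Vec.group d m (Vec.drop r v))

  reassemble : ∀ v → v ≡ prefix v Vec.++ Vec.concat (blocks v)
  reassemble v = trans (sym (Vec.take++drop≡id r v)) (cong (prefix v Vec.++_) (proj₂ (Vec.group d m (Vec.drop r v))))

  blocks-≤ : ∀ {u v} → prefix u ≡ prefix v → Pointwise _≤ᵛ_ (blocks u) (blocks v) → u ≤ᵛ v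
  blocks-≤ {u} {v} eq le = subst₂ _≤ᵛ_ (sym (reassemble u)) (sym (reassemble v))
    (Pointwise.++⁺ (subst (prefix u ≤ᵛ_) eq ≤ᵛ-refl) (Pointwise.concat⁺ le))

  blocks-injective : ∀ {u v} → prefix u ≡ prefix v → blocks u ≡ blocks v → u ≡ v
  blocks-injective {u} {v} eq eq′ =
    trans (reassemble u) (trans (cong₂ (λ p b → p Vec.++ Vec.concat b) eq eq′) (sym (reassemble v)))

  module _ {k : ℕ} where
    All-++⁻ : ∀ {n n′} (u : Vec ℕ n) {v : Vec ℕ n′} → VecAll.All (_< k) (u Vec.++ v) →
      VecAll.All (_< k) u × VecAll.All (_< k) v
    All-++⁻ []      ps       = [] , ps
    All-++⁻ (x ∷ u) (p ∷ ps) = p ∷ proj₁ (All-++⁻ u ps) , proj₂ (All-++⁻ u ps)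

    All-concat⁻ : ∀ {d} (us : Vec (Vec ℕ m) d) → VecAll.All (_< k) (Vec.concat us) → VecAll.All (VecAll.All (_< k)) us
    All-concat⁻ []       ps = []
    All-concat⁻ (u ∷ us) ps = proj₁ (All-++⁻ u ps) ∷ All-concat⁻ us (proj₂ (All-++⁻ u ps))

    pieces : ∀ v → VecAll.All (_< k) v → VecAll.All (_< k) (prefix v) × VecAll.All (VecAll.All (_< k)) (blocks v)
    pieces v v<k = map₂ (All-concat⁻ (blocks v)) (All-++⁻ (prefix v) (subst (VecAll.All (_< k)) (reassemble v) v<k))

-- `A` and `R` are abstract, so that grids and subsets share the argument. Since copies are weak,
-- `ψ` only has to reflect the order: comparable words must come from related points.
module Assembly (P : FinPoset) (h : ℕ) (0<h : 0 < h)
  (ht : Fin (FinPoset.size P) → Fin h) (ht-mono : StrictlyMonotone P h ht)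
  {A : Set} (R : A → A → Set) (R-refl : Reflexive R)
  (k r d m : ℕ) (size≤ : FinPoset.size P ≤ 2 ^ (2 + d))
  (F : List A) (F-unique : Unique F) (F-noCopy : ¬ ContainsWeakCopy P R F)
  (ψ : A → Vec ℕ (r + (2 + d) * m)) (ψ-injective : ∀ {x y} → ψ x ≡ ψ y → x ≡ y)
  (ψ-ordered : ∀ {x y} → ψ x ≤ᵛ ψ y → R x y) (ψ<k : ∀ x → VecAll.All (_< suc k) (ψ x)) where

  open Blocks r (2 + d) m
  open GridBound P h ht ht-mono R R-refl
  open Placement

  private
    K   = suc k
    Chs = chains K m

  InGrid : Vec ℕ r × Vec (List (Vec ℕ m)) (2 + d) → A → Set
  InGrid (ρ , g) x = prefix (ψ x) ≡ ρ × blocks (ψ x) ∈ᵛ g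

  inGrid? : ∀ i → Decidable (InGrid i)
  inGrid? (ρ , g) x = (prefix (ψ x) ≟ᵛ ρ) ×-dec Pointwise.decidable (λ u Γ → Any.any? (u ≟ᵛ_) Γ) (blocks (ψ x)) g

  grids : List (Vec ℕ r × Vec (List (Vec ℕ m)) (2 + d))
  grids = cartesianProductWith _,_ (words K r) (tuples Chs (2 + d))

  ∈-grids : ∀ x → Any (λ i → InGrid i x) grids
  ∈-grids x with find (∈-tuples {P = _∈_} (VecAll.map (∈-chains K) (proj₂ (pieces (ψ x) (ψ<k x)))))
  ... | g , g∈ , bs∈ = lose (∈-cartesianProductWith⁺ _,_ (∈-words (proj₁ (pieces (ψ x) (ψ<k x)))) g∈) (refl , bs∈)

  module _ (ρ : Vec ℕ r) {g : Vec (List (Vec ℕ m)) (2 + d)} (g∈ : g ∈ tuples Chs (2 + d)) where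
    private
      Fᵍ = filter (inGrid? (ρ , g)) F
      φ : A → Vec ℕ (2 + d)
      φ x = positions (blocks (ψ x)) g

    inside : ∀ {x} → x ∈ Fᵍ → x ∈ F × InGrid (ρ , g) x
    inside = ∈-filter⁻ (inGrid? (ρ , g))

    chain-sorted : ∀ {Γ} → Γ ∈ Chs → AllPairs _≤ᵛ_ Γ
    chain-sorted Γ∈ = AllPairs.map proj₁ (saturated-sorted (proj₁ (proj₂ (All.lookup (symmetric-chains k m) Γ∈))))

    chain-nonempty : ∀ {Γ} → Γ ∈ Chs → 1 ≤ length Γ
    chain-nonempty Γ∈ = proj₂ (proj₂ (proj₂ (All.lookup (symmetric-chains k m) Γ∈)))

    sizes-positive : ∀ {d} {g : Vec (List (Vec ℕ m)) d} → VecAll.All (_∈ Chs) g → Positive (sizes g)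
    sizes-positive []       = []
    sizes-positive (p ∷ ps) = chain-nonempty p ∷ sizes-positive ps

    placement : Placement Fᵍ φ (sizes g)
    placement .unique        = Unique.filter⁺ (inGrid? (ρ , g)) F-unique
    placement .noCopy        (π , inj , π∈ , mono) = F-noCopy (π , inj , proj₁ ∘ inside ∘ π∈ , mono)
    placement .ordered x∈ y∈ φx≪φy with inside x∈ | inside y∈
    ... | _ , x≡ρ , bx | _ , y≡ρ , by = ψ-ordered (blocks-≤ (trans x≡ρ (sym y≡ρ))
      (positions-ordered (VecAll.map chain-sorted (∈-tuples⁻ g∈)) bx by φx≪φy))
    placement .bounded x∈    = positions-bounded (proj₂ (proj₂ (inside x∈)))

    φ-fibre : ∀ c → fibre φ Fᵍ c ≤ 1
    φ-fibre c = count-unique (λ x → φ x ≟ᵛ c) (unique placement) same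
      where
      same : ∀ {x y} → x ∈ Fᵍ → y ∈ Fᵍ → φ x ≡ c → φ y ≡ c → x ≡ y
      same x∈ y∈ eq eq′ with inside x∈ | inside y∈
      ... | _ , x≡ρ , bx | _ , y≡ρ , by = ψ-injective (blocks-injective (trans x≡ρ (sym y≡ρ))
        (positions-injective bx by (trans eq (sym eq′))))

    in-grid-bound : length Fᵍ ≤ 72 * (h * T (sizes g))
    in-grid-bound = grid-bound 0<h placement (sizes-positive (∈-tuples⁻ g∈)) φ-fibre size≤

  -- The grid bounds are summed over all prefixes and all tuples of chains. By `∑-T-tuples` with
  -- total K^m, one block contributes the number of chains instead of K^m; the factor K^m on the
  -- left records this saving.
  assembled-bound : length F * K ^ m ≤ 72 * (h * ((2 + d) * (length Chs * K ^ (r + (2 + d) * m))))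
  assembled-bound = begin
    length F * K ^ m
      ≤⟨ *-monoˡ-≤ (K ^ m) (count-cover inGrid? grids F (λ {x} _ → ∈-grids x)) ⟩
    ∑ grids (λ i → count (inGrid? i) F) * K ^ m
      ≡⟨ cong (_* K ^ m) (∑-cartesianProductWith _,_ (words K r) (tuples Chs (2 + d)) _) ⟩
    (∑ (words K r) λ ρ → ∑ (tuples Chs (2 + d)) λ g → count (inGrid? (ρ , g)) F) * K ^ m
      ≤⟨ *-monoˡ-≤ (K ^ m) (∑-mono (words K r) λ {ρ} _ → ∑-mono (tuples Chs (2 + d)) (in-grid-bound ρ)) ⟩
    ∑ (words K r) (λ _ → ∑ (tuples Chs (2 + d)) λ g → 72 * (h * T (sizes g))) * K ^ m
      ≡⟨ cong (_* K ^ m) (trans (∑-const (words K r) _) (cong₂ _*_ (length-words K r)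
           (trans (∑-*ˡ (tuples Chs (2 + d)) 72 _) (cong (72 *_) (∑-*ˡ (tuples Chs (2 + d)) h _))))) ⟩
    K ^ r * (72 * (h * τ)) * K ^ m
      ≡⟨ regroup (K ^ r) h τ (K ^ m) ⟩
    72 * (h * (K ^ r * (K ^ m * τ)))
      ≡⟨ cong (λ t → 72 * (h * (K ^ r * t))) (trans (cong (_* τ) (sym total)) (∑-T-tuples Chs (2 + d))) ⟩
    72 * (h * (K ^ r * ((2 + d) * (length Chs * ∑ Chs length ^ (2 + d)))))
      ≡⟨ cong (λ t → 72 * (h * t)) (collect (K ^ r) (2 + d) (length Chs) _) ⟩
    72 * (h * ((2 + d) * (length Chs * (K ^ r * ∑ Chs length ^ (2 + d)))))
      ≡⟨ cong (λ t → 72 * (h * ((2 + d) * (length Chs * t)))) power ⟩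
    72 * (h * ((2 + d) * (length Chs * K ^ (r + (2 + d) * m)))) ∎
    where
    open ≤-Reasoning
    τ = ∑ (tuples Chs (2 + d)) (T ∘ sizes)
    total : ∑ Chs length ≡ K ^ m
    total = trans (∑-cong Chs length-∑) (trans (∑-chains K m (λ _ → 1))
      (trans (sym (length-∑ (words K m))) (length-words K m)))
    power : K ^ r * ∑ Chs length ^ (2 + d) ≡ K ^ (r + (2 + d) * m)
    power = sym (trans (^-distribˡ-+-* K r _) (cong (K ^ r *_) (trans (cong (K ^_) (*-comm (2 + d) m))
      (trans (sym (^-*-assoc K m (2 + d))) (cong (_^ (2 + d)) (sym total))))))
    regroup : ∀ a h t b → a * (72 * (h * t)) * b ≡ 72 * (h * (a * (b * t)))
    regroup = solve-∀
    collect : ∀ a d w p → a * (d * (w * p)) ≡ d * (w * (a * p))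
    collect = solve-∀

-- The origin of the exponent: squaring turns D into D², and replacing m by n through n ≤ 2Dm adds
-- the third D.
core-squared : ∀ (c f K M h D W N m n : ℕ) .{{_ : NonZero M}} → f * M ≤ c * (h * (D * (W * N))) →
  W ^ 2 * (m * K ^ 2) ≤ 9 * M ^ 2 → n ≤ 2 * D * m →
  f ^ 2 * (n * K ^ 2) ≤ 18 * c ^ 2 * (h ^ 2 * D ^ 3 * N ^ 2)
core-squared c f K M h D W N m n fM≤ W²≤ n≤ = begin
  f ^ 2 * (n * K ^ 2)              ≤⟨ *-monoʳ-≤ (f ^ 2) (*-monoˡ-≤ (K ^ 2) n≤) ⟩
  f ^ 2 * (2 * D * m * K ^ 2)      ≡⟨ assoc f D m K ⟩
  2 * D * (f ^ 2 * (m * K ^ 2))    ≤⟨ *-monoʳ-≤ (2 * D) (*-cancelʳ-≤ _ _ (M ^ 2) {{m^n≢0 M 2}} squared) ⟩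
  2 * D * (9 * c ^ 2 * (h ^ 2 * D ^ 2 * N ^ 2)) ≡⟨ collect c h D N ⟩
  18 * c ^ 2 * (h ^ 2 * D ^ 3 * N ^ 2)  ∎
  where
  open ≤-Reasoning
  assoc : ∀ f d m k → f * (f * 1) * (2 * d * m * (k * (k * 1))) ≡ 2 * d * (f * (f * 1) * (m * (k * (k * 1))))
  assoc = solve-∀
  collect : ∀ c h d n → 2 * d * (9 * (c * (c * 1)) * (h * (h * 1) * (d * (d * 1)) * (n * (n * 1))))
    ≡ 18 * (c * (c * 1)) * (h * (h * 1) * (d * (d * (d * 1))) * (n * (n * 1)))
  collect = solve-∀
  pull : ∀ f m k q → f * (f * 1) * (m * (k * (k * 1))) * (q * (q * 1)) ≡ f * q * (f * q * 1) * (m * (k * (k * 1)))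
  pull = solve-∀
  split : ∀ c h d w n m k → c * (h * (d * (w * n))) * (c * (h * (d * (w * n))) * 1) * (m * (k * (k * 1)))
    ≡ c * (c * 1) * (h * (h * 1) * (d * (d * 1)) * (n * (n * 1))) * (w * (w * 1) * (m * (k * (k * 1))))
  split = solve-∀
  join : ∀ c x q → c * x * (9 * q) ≡ 9 * c * x * q
  join = solve-∀
  squared : f ^ 2 * (m * K ^ 2) * M ^ 2 ≤ 9 * c ^ 2 * (h ^ 2 * D ^ 2 * N ^ 2) * M ^ 2
  squared = begin
    f ^ 2 * (m * K ^ 2) * M ^ 2
      ≡⟨ pull f m K M ⟩
    (f * M) ^ 2 * (m * K ^ 2)
      ≤⟨ *-monoˡ-≤ (m * K ^ 2) (^-monoˡ-≤ 2 fM≤) ⟩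
    (c * (h * (D * (W * N)))) ^ 2 * (m * K ^ 2)
      ≡⟨ split c h D W N m K ⟩
    c ^ 2 * (h ^ 2 * D ^ 2 * N ^ 2) * (W ^ 2 * (m * K ^ 2))
      ≤⟨ *-monoʳ-≤ (c ^ 2 * (h ^ 2 * D ^ 2 * N ^ 2)) W²≤ ⟩
    c ^ 2 * (h ^ 2 * D ^ 2 * N ^ 2) * (9 * M ^ 2)
      ≡⟨ join (c ^ 2) (h ^ 2 * D ^ 2 * N ^ 2) (M ^ 2) ⟩
    9 * c ^ 2 * (h ^ 2 * D ^ 2 * N ^ 2) * M ^ 2 ∎

n≤2^⌈log₂n⌉ : ∀ n → n ≤ 2 ^ ⌈log₂ n ⌉
n≤2^⌈log₂n⌉ n = go n n ≤-refl
  where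
  n≤2*⌈n/2⌉ : ∀ n → n ≤ 2 * ⌈ n /2⌉
  n≤2*⌈n/2⌉ n = ≤-trans (≤-reflexive (sym (⌊n/2⌋+⌈n/2⌉≡n n)))
    (≤-trans (+-monoˡ-≤ ⌈ n /2⌉ (⌊n/2⌋≤⌈n/2⌉ n)) (≤-reflexive (cong (⌈ n /2⌉ +_) (sym (+-identityʳ _)))))
  go : ∀ b n → n ≤ b → n ≤ 2 ^ ⌈log₂ n ⌉
  go b 0 _ = z≤n
  go b 1 _ = ≤-refl
  go (suc b) n@(suc (suc i)) (s≤s n≤b) = begin
    n                            ≤⟨ n≤2*⌈n/2⌉ n ⟩
    2 * ⌈ n /2⌉                  ≤⟨ *-monoʳ-≤ 2 (go b ⌈ n /2⌉ (≤-trans (s≤s⁻¹ (⌈n/2⌉<n i)) n≤b)) ⟩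
    2 * 2 ^ ⌈log₂ ⌈ n /2⌉ ⌉      ≡⟨ cong (λ l → 2 ^ suc l) (⌈log₂⌈n/2⌉⌉≡⌈log₂n⌉∸1 n) ⟩
    2 ^ suc (⌈log₂ n ⌉ ∸ 1)      ≡⟨ cong (2 ^_) (m+[n∸m]≡n (⌈log₂⌉-mono-≤ (s≤s (s≤s (z≤n {i}))))) ⟩
    2 ^ ⌈log₂ n ⌉                ∎
    where open ≤-Reasoning

^2-cancel-≤ : ∀ {a b} → a ^ 2 ≤ b ^ 2 → a ≤ b
^2-cancel-≤ {a} {b} a²≤b² = ≮⇒≥ λ b<a → <⇒≱ (subst₂ _<_ (sq b) (sq a) (*-mono-< b<a b<a)) a²≤b²
  where
  sq : ∀ x → x * x ≡ x ^ 2
  sq x = cong (x *_) (sym (*-identityʳ x))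

⌈log₂⌉-sqrt : ∀ {p} j → p ^ 2 ≤ 2 ^ (j + j) → ⌈log₂ p ⌉ ≤ j
⌈log₂⌉-sqrt {p} j p²≤ = ≤-trans (⌈log₂⌉-mono-≤ (^2-cancel-≤ {p} {2 ^ j} (≤-trans p²≤ (≤-reflexive double))))
                                (≤-reflexive (⌈log₂2^n⌉≡n j))
  where
  double : 2 ^ (j + j) ≡ (2 ^ j) ^ 2
  double = trans (^-distribˡ-+-* 2 j j) (cong (2 ^ j *_) (sym (*-identityʳ (2 ^ j))))

-- This turns n ≥ 2 log₂ |P| into D ≤ n, so that the blocks have length m ≥ 1. Rounding the
-- logarithm up is harmless because it is at most ⌈n/2⌉.
1+⌈log₂⌉≤ : ∀ {p n} → 2 ≤ p → p ^ 2 ≤ 2 ^ n → suc ⌈log₂ p ⌉ ≤ n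
1+⌈log₂⌉≤ {p} {n} 2≤p p²≤2ⁿ with even-or-odd n
... | zero , inj₁ refl = ⊥-elim (<⇒≱ (≤-trans (s≤s (s≤s z≤n)) (^-monoˡ-≤ 2 2≤p)) p²≤2ⁿ)
... | zero , inj₂ refl = ⊥-elim (<⇒≱ (≤-trans (m≤m+n 3 1) (^-monoˡ-≤ 2 2≤p)) p²≤2ⁿ)
... | suc j , inj₁ refl = s≤s (≤-trans (⌈log₂⌉-sqrt {p} (suc j) p²≤2ⁿ) (m≤n+m (suc j) j))
... | suc j , inj₂ refl = s≤s (≤-trans
  (⌈log₂⌉-sqrt {p} (suc (suc j)) (≤-trans p²≤2ⁿ (^-monoʳ-≤ 2 (s≤s (+-monoʳ-≤ (suc j) (n≤1+n (suc j)))))))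
  (s≤s (m≤n+m (suc j) j)))

1≤⌈log₂⌉ : ∀ {p} → 2 ≤ p → 1 ≤ ⌈log₂ p ⌉
1≤⌈log₂⌉ 2≤p = ⌈log₂⌉-mono-≤ 2≤p

module _ (P : FinPoset) {A : Set} (R : A → A → Set) (R-refl : Reflexive R) where

  open FinPoset P using (size; _≼_)

  -- Here ⌈log₂ size⌉ = 0, so the bound claims that `F` is empty; indeed any point of `F` yields a
  -- weak copy.
  small-poset : size ≤ 1 → (F : List A) → ¬ ContainsWeakCopy P R F → F ≡ []
  small-poset size≤1 []      _      = refl
  small-poset size≤1 (x ∷ F) noCopy = ⊥-elim (noCopy
    ((λ _ → x) , (λ _ → Fin≤1 _ _ size≤1) , (λ _ → here refl) , (λ _ _ _ → R-refl)))
    where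
    Fin≤1 : ∀ {n} (i j : Fin n) → n ≤ 1 → i ≡ j
    Fin≤1 zero zero (s≤s z≤n) = refl

  -- The bound before any width enters: |F| ≤ 12 c h L^(3/2) k^(n-1)/√n, squared. Both versions
  -- follow by comparing k^(n-1)/√n with a width or a binomial coefficient.
  core-bound : ∀ {c h k n} → 72 ≤ c → IsHeight _≼_ h → 2 ≤ k → size ^ 2 ≤ 2 ^ n →
    (ψ : A → Vec ℕ n) → (∀ {x y} → ψ x ≡ ψ y → x ≡ y) → (∀ {x y} → ψ x ≤ᵛ ψ y → R x y) →
    (∀ x → VecAll.All (_< k) (ψ x)) → (F : List A) → Unique F → ¬ ContainsWeakCopy P R F →
    length F ^ 2 * (n * k ^ 2) ≤ 144 * c ^ 2 * (h ^ 2 * ⌈log₂ size ⌉ ^ 3 * (k ^ n) ^ 2)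
  core-bound {c} {h} {k} {n} 72≤c isH 2≤k size²≤ ψ ψ-injective ψ-ordered ψ<k F F-unique noCopy with size ≤? 1
  ... | yes size≤1 rewrite small-poset size≤1 F noCopy = z≤n
  -- The goal is a decidable inequality, so a height function up to double negation is enough.
  ... | no  size≰1 = decidable-stable (_ ≤? _) (¬¬-map with-height (¬¬-height P isH))
    where
    open ≤-Reasoning
    2≤size : 2 ≤ size
    2≤size = ≰⇒> size≰1
    L = ⌈log₂ size ⌉
    1≤L = 1≤⌈log₂⌉ 2≤size
    -- The successor guarantees D ≥ 2, as `grid-bound` works with at least two sides.
    D = suc L
    8L³ : D ^ 3 ≤ 8 * L ^ 3
    8L³ = ≤-trans (^-monoˡ-≤ 3 D≤2L) (≤-reflexive (^-distribʳ-* 3 2 L))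
      where
      D≤2L : D ≤ 2 * L
      D≤2L = ≤-trans (+-monoˡ-≤ L 1≤L) (≤-reflexive (cong (L +_) (sym (+-identityʳ L))))
    size≤2^D : size ≤ 2 ^ D
    size≤2^D = ≤-trans (n≤2^⌈log₂n⌉ size) (^-monoʳ-≤ 2 (n≤1+n L))

    with-height : Σ (Fin size → Fin h) (StrictlyMonotone P h) →
      length F ^ 2 * (n * k ^ 2) ≤ 144 * c ^ 2 * (h ^ 2 * L ^ 3 * (k ^ n) ^ 2)
    with-height (ht , ht-mono) = begin
      length F ^ 2 * (n * k ^ 2)
        ≤⟨ decompose D (1≤⇒2≤ 1≤L) size≤2^D k 2≤k ψ ψ-injective ψ-ordered ψ<k (n % D) (n / D)
             (trans (m≡m%n+[m/n]*n n D) (cong (n % D +_) (*-comm (n / D) D)))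
             (m≥n⇒m/n>0 (1+⌈log₂⌉≤ {n = n} 2≤size size²≤)) (m%n<n n D) ⟩
      18 * c ^ 2 * (h ^ 2 * D ^ 3 * (k ^ n) ^ 2)
        ≤⟨ *-monoʳ-≤ (18 * c ^ 2) (*-monoˡ-≤ ((k ^ n) ^ 2) (*-monoʳ-≤ (h ^ 2) 8L³)) ⟩
      18 * c ^ 2 * (h ^ 2 * (8 * L ^ 3) * (k ^ n) ^ 2)
        ≡⟨ ring (c ^ 2) (h ^ 2) (L ^ 3) ((k ^ n) ^ 2) ⟩
      144 * c ^ 2 * (h ^ 2 * L ^ 3 * (k ^ n) ^ 2) ∎
      where
      ring : ∀ e a b c → 18 * e * (a * (8 * b) * c) ≡ 144 * e * (a * b * c)
      ring = solve-∀
      1≤⇒2≤ : ∀ {l} → 1 ≤ l → 2 ≤ suc l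
      1≤⇒2≤ = s≤s
      0<h : 0 < h
      0<h = ≤-<-trans z≤n (toℕ<n (ht (fromℕ< 2≤size)))
      -- D, k and n are made variables so that n can be identified with r + D * m by matching, which
      -- retypes `ψ` without transport.
      decompose : ∀ D → 2 ≤ D → size ≤ 2 ^ D → ∀ k → 2 ≤ k → ∀ {n} (ψ : A → Vec ℕ n) →
        (∀ {x y} → ψ x ≡ ψ y → x ≡ y) → (∀ {x y} → ψ x ≤ᵛ ψ y → R x y) →
        (∀ x → VecAll.All (_< k) (ψ x)) → ∀ r m → n ≡ r + D * m → 1 ≤ m → r < D →
        length F ^ 2 * (n * k ^ 2) ≤ 18 * c ^ 2 * (h ^ 2 * D ^ 3 * (k ^ n) ^ 2)
      decompose (suc (suc d)) (s≤s (s≤s _)) size≤ (suc k) 2≤k ψ ψ-inj ψ-ord ψ<k r m refl 1≤m r<D =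
        core-squared c (length F) (suc k) (suc k ^ m) h (2 + d) (length (chains (suc k) m)) (suc k ^ n′) m n′
          {{m^n≢0 (suc k) m}}
          (≤-trans (Assembly.assembled-bound P h 0<h ht ht-mono R R-refl k r d m size≤ F F-unique noCopy ψ ψ-inj ψ-ord ψ<k)
            (*-monoˡ-≤ _ 72≤c))
          (chains-bound (suc k) m 2≤k 1≤m) n≤
        where
        n′ = r + (2 + d) * m
        n≤ : n′ ≤ 2 * (2 + d) * m
        n≤ = begin
          r + (2 + d) * m                 ≤⟨ +-monoˡ-≤ _ (≤-trans (<⇒≤ r<D) (m≤m*n (2 + d) m {{>-nonZero 1≤m}})) ⟩
          (2 + d) * m + (2 + d) * m       ≡⟨ ring₂ (2 + d) m ⟩
          2 * (2 + d) * m                 ∎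
          where
          ring₂ : ∀ d m → d * m + d * m ≡ 2 * d * m
          ring₂ = solve-∀

-- A lower bound for the width

∑-upTo-2* : ∀ q → ∑ (upTo (suc q)) (2 *_) ≡ suc q * q
∑-upTo-2* zero    = refl
∑-upTo-2* (suc q) = trans (∑-upTo-suc (suc q) (2 *_)) (trans (cong (_+ 2 * suc q) (∑-upTo-2* q)) (ring q))
  where
  ring : ∀ q → suc q * q + 2 * suc q ≡ suc (suc q) * suc q
  ring = solve-∀

sq : ℕ → ℕ
sq x = x * x

-- For a uniform letter j, the doubled letter has mean q; its second moment is bounded by q² plus
-- the crude variance bound k².
∑-upTo-sq : ∀ q → ∑ (upTo (suc q)) (λ j → sq (2 * j)) ≤ suc q * (sq q + sq (suc q))
∑-upTo-sq zero    = z≤n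
∑-upTo-sq (suc q) = begin
  ∑ (upTo (suc (suc q))) (λ j → sq (2 * j))
    ≡⟨ ∑-upTo-suc (suc q) (λ j → sq (2 * j)) ⟩
  ∑ (upTo (suc q)) (λ j → sq (2 * j)) + sq (2 * suc q)
    ≤⟨ +-monoˡ-≤ _ (∑-upTo-sq q) ⟩
  suc q * (q * q + suc q * suc q) + 2 * suc q * (2 * suc q)
    ≤⟨ m≤m+n _ (2 * q * q + 6 * q + 5) ⟩
  suc q * (q * q + suc q * suc q) + 2 * suc q * (2 * suc q) + (2 * q * q + 6 * q + 5)
    ≡⟨ ring q ⟩
  suc (suc q) * (suc q * suc q + suc (suc q) * suc (suc q)) ∎
  where
  open ≤-Reasoning
  ring : ∀ q → suc q * (q * q + suc q * suc q) + 2 * suc q * (2 * suc q) + (2 * q * q + 6 * q + 5)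
    ≡ suc (suc q) * (suc q * suc q + suc (suc q) * suc (suc q))
  ring = solve-∀

markov : ∀ {A : Set} {P : A → Set} (P? : Decidable P) (f : A → ℕ) s → (∀ x → ¬ P x → s ≤ f x) →
  ∀ xs → s * length xs ≤ s * count P? xs + ∑ xs f
markov P? f s s≤ []       = ≤-reflexive (sym (+-identityʳ _))
markov P? f s s≤ (x ∷ xs) with P? x
... | yes _ = begin
  s * suc (length xs)                         ≡⟨ *-suc s _ ⟩
  s + s * length xs                           ≤⟨ +-monoʳ-≤ s (markov P? f s s≤ xs) ⟩
  s + (s * count P? xs + ∑ xs f)              ≤⟨ +-monoʳ-≤ s (+-monoʳ-≤ _ (m≤n+m (∑ xs f) (f x))) ⟩
  s + (s * count P? xs + (f x + ∑ xs f))      ≡⟨ trans (sym (+-assoc s _ _)) (cong (_+ (f x + ∑ xs f)) (sym (*-suc s _))) ⟩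
  s * suc (count P? xs) + (f x + ∑ xs f)      ∎
  where open ≤-Reasoning
... | no ¬p = begin
  s * suc (length xs)                         ≡⟨ *-suc s _ ⟩
  s + s * length xs                           ≤⟨ +-mono-≤ (s≤ x ¬p) (markov P? f s s≤ xs) ⟩
  f x + (s * count P? xs + ∑ xs f)            ≡⟨ swap (f x) _ (∑ xs f) ⟩
  s * count P? xs + (f x + ∑ xs f)            ∎
  where
  open ≤-Reasoning
  swap : ∀ a b c → a + (b + c) ≡ b + (a + c)
  swap = solve-∀

module _ (q : ℕ) where
  private
    k = suc q

  -- Ranks are doubled so that the mean n q is an integer.
  first-moment : ∀ n → ∑ (words k n) (λ v → 2 * rank v) ≡ n * q * k ^ n
  first-moment zero    = refl
  first-moment (suc n) = begin
    ∑ (words k (suc n)) (λ v → 2 * rank v)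
      ≡⟨ ∑-tuples-suc (upTo k) n _ ⟩
    (∑ (upTo k) λ j → ∑ (words k n) λ v → 2 * (j + rank v))
      ≡⟨ ∑-cong (upTo k) (λ j → trans (∑-cong (words k n) λ v → *-distribˡ-+ 2 j (rank v))
           (trans (∑-+ (words k n) _ _) (cong₂ _+_
             (trans (∑-const (words k n) (2 * j)) (trans (cong (_* (2 * j)) (length-words k n)) (*-comm (k ^ n) (2 * j))))
             (first-moment n)))) ⟩
    ∑ (upTo k) (λ j → 2 * j * k ^ n + n * q * k ^ n)
      ≡⟨ trans (∑-+ (upTo k) (λ j → 2 * j * k ^ n) (λ _ → n * q * k ^ n)) (cong₂ _+_
           (trans (∑-*ʳ (upTo k) (2 *_) (k ^ n)) (cong (_* k ^ n) (∑-upTo-2* q)))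
           (trans (∑-const (upTo k) _) (cong (_* (n * q * k ^ n)) (length-upTo k)))) ⟩
    k * q * k ^ n + k * (n * q * k ^ n)
      ≡⟨ ring q n (k ^ n) ⟩
    suc n * q * (k * k ^ n) ∎
    where
    open ≡-Reasoning
    ring : ∀ q n p → suc q * q * p + suc q * (n * q * p) ≡ suc n * q * (suc q * p)
    ring = solve-∀

  second-moment : ∀ n → ∑ (words k n) (λ v → sq (2 * rank v)) ≤ (sq (n * q) + n * sq k) * k ^ n
  second-moment zero    = z≤n
  second-moment (suc n) = begin
    ∑ (words k (suc n)) (λ v → sq (2 * rank v))
      ≡⟨ ∑-tuples-suc (upTo k) n _ ⟩
    (∑ (upTo k) λ j → ∑ (words k n) λ v → sq (2 * (j + rank v)))
      ≡⟨ ∑-cong (upTo k) (λ j → trans (∑-cong (words k n) λ v → expand j (rank v))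
           (trans (∑-+ (words k n) _ _) (cong₂ _+_
             (trans (∑-+ (words k n) _ _) (cong₂ _+_
               (trans (∑-const (words k n) (sq (2 * j))) (trans (cong (_* sq (2 * j)) (length-words k n)) (*-comm (k ^ n) (sq (2 * j)))))
               (trans (∑-*ˡ (words k n) (2 * (2 * j)) _) (cong (2 * (2 * j) *_) (first-moment n)))))
             refl))) ⟩
    ∑ (upTo k) (λ j → sq (2 * j) * k ^ n + 2 * (2 * j) * (n * q * k ^ n) + Σ²)
      ≡⟨ trans (∑-+ (upTo k) (λ j → sq (2 * j) * k ^ n + 2 * (2 * j) * (n * q * k ^ n)) (λ _ → Σ²)) (cong₂ _+_
           (trans (∑-+ (upTo k) (λ j → sq (2 * j) * k ^ n) (λ j → 2 * (2 * j) * (n * q * k ^ n))) (cong₂ _+_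
           (∑-*ʳ (upTo k) (λ j → sq (2 * j)) (k ^ n))
           (trans (∑-*ʳ (upTo k) (λ j → 2 * (2 * j)) (n * q * k ^ n))
             (cong (_* (n * q * k ^ n)) (trans (∑-*ˡ (upTo k) 2 (2 *_)) (cong (2 *_) (∑-upTo-2* q)))))))
           (trans (∑-const (upTo k) Σ²) (cong (_* Σ²) (length-upTo k)))) ⟩
    ∑ (upTo k) (λ j → sq (2 * j)) * k ^ n + 2 * (k * q) * (n * q * k ^ n) + k * Σ²
      ≤⟨ +-mono-≤ (+-monoˡ-≤ _ (*-monoˡ-≤ (k ^ n) (∑-upTo-sq q))) (*-monoʳ-≤ k (second-moment n)) ⟩
    suc q * (sq q + sq k) * k ^ n + 2 * (k * q) * (n * q * k ^ n) + k * ((sq (n * q) + n * sq k) * k ^ n)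
      ≡⟨ ring q n (k ^ n) ⟩
    (sq (suc n * q) + suc n * sq k) * (k * k ^ n) ∎
    where
    open ≤-Reasoning
    Σ² = ∑ (words k n) (λ v → sq (2 * rank v))
    expand : ∀ j r → 2 * (j + r) * (2 * (j + r)) ≡ 2 * j * (2 * j) + 2 * (2 * j) * (2 * r) + 2 * r * (2 * r)
    expand = solve-∀
    ring : ∀ q n p → suc q * (q * q + suc q * suc q) * p + 2 * (suc q * q) * (n * q * p)
        + suc q * ((n * q * (n * q) + n * (suc q * suc q)) * p)
      ≡ (suc n * q * (suc n * q) + suc n * (suc q * suc q)) * (suc q * p)
    ring = solve-∀

  sq-∣-∣ : ∀ x y → sq ∣ x - y ∣ + 2 * x * y ≡ sq x + sq y
  sq-∣-∣ zero    y = +-identityʳ _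
  sq-∣-∣ (suc x) zero = cong (sq (suc x) +_) (*-zeroʳ (2 * suc x))
  sq-∣-∣ (suc x) (suc y) = begin
    sq ∣ x - y ∣ + 2 * suc x * suc y           ≡⟨ expand (sq ∣ x - y ∣) x y ⟩
    sq ∣ x - y ∣ + 2 * x * y + (2 * x + 2 * y + 2) ≡⟨ cong (_+ (2 * x + 2 * y + 2)) (sq-∣-∣ x y) ⟩
    sq x + sq y + (2 * x + 2 * y + 2)          ≡⟨ collect x y ⟩
    sq (suc x) + sq (suc y)                    ∎
    where
    open ≡-Reasoning
    expand : ∀ s x y → s + 2 * suc x * suc y ≡ s + 2 * x * y + (2 * x + 2 * y + 2)
    expand = solve-∀
    collect : ∀ x y → x * x + y * y + (2 * x + 2 * y + 2) ≡ suc x * suc x + suc y * suc y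
    collect = solve-∀

  -- Second moment minus squared mean; the cross term is added to both sides to avoid subtraction.
  variance : ∀ n → ∑ (words k n) (λ v → sq ∣ 2 * rank v - n * q ∣) ≤ n * sq k * k ^ n
  variance n = +-cancelʳ-≤ (2 * (N * k ^ n) * N) _ _ (begin
    V + 2 * (N * k ^ n) * N
      ≡⟨ cong (V +_) (sym cross) ⟩
    V + ∑ (words k n) (λ v → 2 * (2 * rank v) * N)
      ≡⟨ trans (sym (∑-+ (words k n) _ _)) (trans (∑-cong (words k n) λ v → sq-∣-∣ (2 * rank v) N)
           (trans (∑-+ (words k n) _ _) (cong (∑ (words k n) (λ v → sq (2 * rank v)) +_)
             (trans (∑-const (words k n) (sq N)) (cong (_* sq N) (length-words k n)))))) ⟩
    ∑ (words k n) (λ v → sq (2 * rank v)) + k ^ n * sq N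
      ≤⟨ +-monoˡ-≤ _ (second-moment n) ⟩
    (sq N + n * sq k) * k ^ n + k ^ n * sq N
      ≡⟨ ring N (n * sq k) (k ^ n) ⟩
    n * sq k * k ^ n + 2 * (N * k ^ n) * N ∎)
    where
    open ≤-Reasoning
    N = n * q
    V = ∑ (words k n) (λ v → sq ∣ 2 * rank v - N ∣)
    cross : ∑ (words k n) (λ v → 2 * (2 * rank v) * N) ≡ 2 * (N * k ^ n) * N
    cross = trans (∑-*ʳ (words k n) (λ v → 2 * (2 * rank v)) N) (cong (_* N)
      (trans (∑-*ˡ (words k n) 2 (λ v → 2 * rank v)) (cong (2 *_) (first-moment n))))
    ring : ∀ N s p → (N * N + s) * p + p * (N * N) ≡ s * p + 2 * (N * p) * N
    ring = solve-∀

  module _ (n t : ℕ) where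

    near? : Decidable (λ (v : Vec ℕ n) → ∣ 2 * rank v - n * q ∣ < t)
    near? v = ∣ 2 * rank v - n * q ∣ <? t

    -- Chebyshev's inequality: t² is at least twice the variance bound, so at most half of the words
    -- are at distance t or more from the mean.
    near-half : 2 * (n * sq k) ≤ sq t → 0 < t → k ^ n ≤ 2 * count near? (words k n)
    near-half 2nk²≤t² 0<t = *-cancelˡ-≤ (sq t) {{>-nonZero (*-mono-≤ 0<t 0<t)}} (+-cancelʳ-≤ (sq t * k ^ n) _ _ (begin
      sq t * k ^ n + sq t * k ^ n        ≡⟨ double (sq t * k ^ n) ⟩
      2 * (sq t * k ^ n)                 ≤⟨ *-monoʳ-≤ 2 (≤-trans (≤-reflexive (cong (sq t *_) (sym (length-words k n))))
                                              (≤-trans (markov near? _ (sq t) (λ _ ≮t → *-mono-≤ (≮⇒≥ ≮t) (≮⇒≥ ≮t)) (words k n)) (+-monoʳ-≤ _ (variance n)))) ⟩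
      2 * (sq t * c + n * sq k * k ^ n)  ≡⟨ regroup (sq t) c (n * sq k) (k ^ n) ⟩
      sq t * (2 * c) + 2 * (n * sq k) * k ^ n ≤⟨ +-monoʳ-≤ _ (*-monoˡ-≤ (k ^ n) 2nk²≤t²) ⟩
      sq t * (2 * c) + sq t * k ^ n      ∎))
      where
      open ≤-Reasoning
      c = count near? (words k n)
      double : ∀ a → a + a ≡ 2 * a
      double = solve-∀
      regroup : ∀ s c v p → 2 * (s * c + v * p) ≡ s * (2 * c) + 2 * v * p
      regroup = solve-∀

    -- 2r lies in an open interval of length 2t, so r takes at most t values, counted down from the
    -- top.
    near-layer : ∀ r → ∣ 2 * r - n * q ∣ < t → Σ ℕ λ i → i < t × r ≡ ⌊ n * q + t /2⌋ ∸ i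
    near-layer r lt = c₀ ∸ r , +-cancelˡ-< r _ _ (subst (_< r + t) (sym (m+[n∸m]≡n r≤c₀)) c₀<r+t) , sym (m∸[m∸n]≡n r≤c₀)
      where
      open ≤-Reasoning
      N  = n * q
      c₀ = ⌊ N + t /2⌋
      r+r : 2 * r ≡ r + r
      r+r = cong (r +_) (+-identityʳ r)
      r≤c₀ : r ≤ c₀
      r≤c₀ = ≤-trans (≤-reflexive (n≡⌊n+n/2⌋ r)) (⌊n/2⌋-mono (begin
        r + r                 ≡⟨ sym r+r ⟩
        2 * r                 ≤⟨ m≤n+∣m-n∣ (2 * r) N ⟩
        N + ∣ 2 * r - N ∣     ≤⟨ +-monoʳ-≤ N (<⇒≤ lt) ⟩
        N + t                 ∎))
      c₀<r+t : c₀ < r + t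
      c₀<r+t = ≤-<-trans (⌊n/2⌋-mono (begin
          N + t                       ≤⟨ +-monoˡ-≤ t (m≤n+∣n-m∣ N (2 * r)) ⟩
          2 * r + ∣ 2 * r - N ∣ + t   ≡⟨ cong (λ x → x + ∣ 2 * r - N ∣ + t) r+r ⟩
          r + r + ∣ 2 * r - N ∣ + t   ≤⟨ +-monoˡ-≤ t (+-monoʳ-≤ (r + r) (≤-pred-∸ lt)) ⟩
          r + r + (t ∸ 1) + t         ≡⟨ rearrange r (t ∸ 1) t ⟩
          (r + (t ∸ 1)) + (r + t)     ≤⟨ ≤-refl ⟩
          (r + (t ∸ 1)) + (r + t)     ≡⟨ cong ((r + (t ∸ 1)) +_) r+t ⟩
          (r + (t ∸ 1)) + suc (r + (t ∸ 1)) ≡⟨ +-suc _ _ ⟩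
          suc ((r + (t ∸ 1)) + (r + (t ∸ 1))) ∎))
        (≤-<-trans (≤-reflexive (sym (n≡⌈n+n/2⌉ (r + (t ∸ 1))))) (≤-reflexive (sym r+t)))
        where
        ≤-pred-∸ : ∀ {x y} → x < y → x ≤ y ∸ 1
        ≤-pred-∸ (s≤s x≤y) = x≤y
        1≤t : 1 ≤ t
        1≤t = ≤-<-trans z≤n lt
        r+t : r + t ≡ suc (r + (t ∸ 1))
        r+t = trans (cong (r +_) (sym (m+[n∸m]≡n 1≤t))) (+-suc r (t ∸ 1))
        rearrange : ∀ r s t → r + r + s + t ≡ (r + s) + (r + t)
        rearrange = solve-∀

    window-bound : ∀ w → (∀ c → count (λ v → rank v ≟ c) (words k n) ≤ w) → count near? (words k n) ≤ t * w
    window-bound w layer≤ = ≤-trans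
      (count-cover-const (λ i v → rank v ≟ ⌊ n * q + t /2⌋ ∸ i) (upTo t) (filter near? (words k n)) w
        (λ {v} v∈ → let i , i<t , eq = near-layer (rank v) (proj₂ (∈-filter⁻ near? {xs = words k n} v∈))
                    in lose (∈-upTo⁺ i<t) eq)
        (λ i → ≤-trans (count-filter (λ v → rank v ≟ _) near? (words k n)) (layer≤ _)))
      (≤-reflexive (cong (_* w) (length-upTo t)))

-- `s` is kept until s² = n + 1, and only then increased; the factor 4 leaves room for that jump.
√-approx : ∀ n → Σ ℕ λ s → suc n ≤ sq s × sq s ≤ 4 * suc n
√-approx zero = 1 , ≤-refl , s≤s z≤n
√-approx (suc n) with √-approx n
... | s , n<s² , s²≤ with suc (suc n) ≤? sq s
...   | yes p = s , p , ≤-trans s²≤ (*-monoʳ-≤ 4 (n≤1+n (suc n)))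
...   | no ¬p = suc s , ≤-trans (s≤s n<s²) lower , upper
  where
  open ≤-Reasoning
  s²≡ : sq s ≡ suc n
  s²≡ = ≤-antisym (s≤s⁻¹ (≰⇒> ¬p)) n<s²
  expand : ∀ s → suc s * suc s ≡ suc (s * s) + 2 * s
  expand = solve-∀
  lower : suc (sq s) ≤ sq (suc s)
  lower = ≤-trans (m≤m+n _ (2 * s)) (≤-reflexive (sym (expand s)))
  upper : sq (suc s) ≤ 4 * suc (suc n)
  upper = begin
    sq (suc s)              ≡⟨ expand s ⟩
    suc (sq s) + 2 * s      ≤⟨ +-mono-≤ (s≤s (≤-refl {sq s})) (*-monoʳ-≤ 2 (s≤s² s)) ⟩
    suc (sq s) + 2 * sq s   ≤⟨ m≤m+n _ (3 + sq s) ⟩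
    suc (sq s) + 2 * sq s + (3 + sq s) ≡⟨ collect (sq s) ⟩
    4 * suc (sq s)          ≡⟨ cong (λ x → 4 * suc x) s²≡ ⟩
    4 * suc (suc n)         ∎
    where
    collect : ∀ x → suc x + 2 * x + (3 + x) ≡ 4 * suc x
    collect = solve-∀
    s≤s² : ∀ s → s ≤ sq s
    s≤s² zero    = z≤n
    s≤s² (suc s) = m≤m+n (suc s) (s * suc s)

-- With t = 2ks and s ≈ √n, half of all words lie in t layers. As s is at most twice the square
-- root, k^n ≤ 2tw ≤ 8k√n w, which is squared here; in this reading n is the full dimension.
width-lower : ∀ q n w → (∀ c → count (λ v → rank v ≟ c) (words (suc q) (suc n)) ≤ w) →
  (suc q ^ suc n) ^ 2 ≤ 64 * (suc n * suc q ^ 2) * w ^ 2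
width-lower q n w layer≤ with √-approx n
... | s , n≤s² , s²≤ = begin
  (k ^ suc n) ^ 2               ≤⟨ ^-monoˡ-≤ 2 (near-half q (suc n) t 2nk²≤t² 0<t) ⟩
  (2 * count (near? q (suc n) t) (words k (suc n))) ^ 2
                                ≤⟨ ^-monoˡ-≤ 2 (*-monoʳ-≤ 2 (window-bound q (suc n) t w layer≤)) ⟩
  (2 * (t * w)) ^ 2             ≡⟨ expand k s w ⟩
  16 * (k * k) * sq s * w ^ 2   ≤⟨ *-monoˡ-≤ (w ^ 2) (*-monoʳ-≤ (16 * (k * k)) s²≤) ⟩
  16 * (k * k) * (4 * suc n) * w ^ 2 ≡⟨ collect k (suc n) w ⟩
  64 * (suc n * k ^ 2) * w ^ 2  ∎
  where
  open ≤-Reasoning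
  k = suc q
  t = 2 * (k * s)
  expand : ∀ k s w → 2 * (2 * (k * s) * w) * (2 * (2 * (k * s) * w) * 1) ≡ 16 * (k * k) * (s * s) * (w * (w * 1))
  expand = solve-∀
  collect : ∀ k n w → 16 * (k * k) * (4 * n) * (w * (w * 1)) ≡ 64 * (n * (k * (k * 1))) * (w * (w * 1))
  collect = solve-∀
  0<s : ∀ s → suc n ≤ sq s → 0 < s
  0<s (suc s) _ = s≤s z≤n
  0<t : 0 < t
  0<t = *-mono-≤ {1} {2} (s≤s z≤n) (*-mono-≤ {1} {k} (s≤s z≤n) (0<s s n≤s²))
  2nk²≤t² : 2 * (suc n * sq k) ≤ sq t
  2nk²≤t² = begin
    2 * (suc n * sq k)   ≤⟨ *-mono-≤ (m≤m+n 2 2) (*-monoˡ-≤ (sq k) n≤s²) ⟩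
    4 * (sq s * sq k)    ≡⟨ square s k ⟩
    sq t                 ∎
    where
    square : ∀ s k → 4 * (s * s * (k * k)) ≡ 2 * (k * s) * (2 * (k * s))
    square = solve-∀

-- Antichains from layers, and subsets as words

private
  variable
    k n : ℕ

∑-δ-count : ∀ {A : Set} (g : A → ℕ) c xs → ∑ xs (δ c ∘ g) ≡ count (λ x → g x ≟ c) xs
∑-δ-count g c []       = refl
∑-δ-count g c (x ∷ xs) = case g x ≟ c of λ where
  (yes eq) → trans (cong₂ _+_ (trans (cong (δ c) eq) (δ-refl c)) (∑-δ-count g c xs))
                   (sym (count-accept (λ x → g x ≟ c) xs eq))
  (no neq) → trans (cong₂ _+_ (δ-≢ neq) (∑-δ-count g c xs))
                   (sym (cong length (filter-reject (λ x → g x ≟ c) neq)))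

allGrid : ∀ k n → List (Grid k n)
allGrid k n = tuples (allFin k) n

values : Grid k n → Vec ℕ n
values = Vec.map toℕ

upTo-allFin : ∀ k → upTo k ≡ map toℕ (allFin k)
upTo-allFin k = trans (applyUpTo-tabulate id k) (sym (map-tabulate id toℕ))
  where
  applyUpTo-tabulate : ∀ {A : Set} (f : ℕ → A) n → Data.List.applyUpTo f n ≡ tabulate {n = n} (f ∘ toℕ)
  applyUpTo-tabulate f zero    = refl
  applyUpTo-tabulate f (suc n) = cong (f 0 ∷_) (applyUpTo-tabulate (f ∘ suc) n)

∑-words-allGrid : ∀ k n f → ∑ (words k n) f ≡ ∑ (allGrid k n) (f ∘ values)
∑-words-allGrid k zero    f = refl
∑-words-allGrid k (suc n) f = begin
  ∑ (words k (suc n)) f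
    ≡⟨ ∑-tuples-suc (upTo k) n f ⟩
  ∑ (upTo k) (λ j → ∑ (words k n) λ v → f (j ∷ v))
    ≡⟨ ∑-cong (upTo k) (λ j → ∑-words-allGrid k n (λ v → f (j ∷ v))) ⟩
  ∑ (upTo k) (λ j → ∑ (allGrid k n) λ v → f (j ∷ values v))
    ≡⟨ trans (cong (λ l → ∑ l (λ j → ∑ (allGrid k n) λ v → f (j ∷ values v))) (upTo-allFin k)) (∑-map toℕ (allFin k) _) ⟩
  ∑ (allFin k) (λ i → ∑ (allGrid k n) λ v → f (toℕ i ∷ values v))
    ≡⟨ sym (∑-tuples-suc (allFin k) n (f ∘ values)) ⟩
  ∑ (allGrid k (suc n)) (f ∘ values) ∎
  where open ≡-Reasoning

unique-tuples : ∀ {A : Set} {xs : List A} n → Unique xs → Unique (tuples xs n)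
unique-tuples zero    u = [] ∷ []
unique-tuples (suc n) u = Unique.cartesianProductWith⁺ _∷_ Vec.∷-injective u (unique-tuples n u)

≤ᵍ⇒≤ᵛ : (u v : Grid k n) → u ≤ᵍ v → values u ≤ᵛ values v
≤ᵍ⇒≤ᵛ []      []      le = []
≤ᵍ⇒≤ᵛ (x ∷ u) (y ∷ v) le = le zero ∷ ≤ᵍ⇒≤ᵛ u v (le ∘ suc)

≤ᵛ⇒≤ᵍ : (u v : Grid k n) → values u ≤ᵛ values v → u ≤ᵍ v
≤ᵛ⇒≤ᵍ (x ∷ u) (y ∷ v) (x≤y ∷ le) zero    = x≤y
≤ᵛ⇒≤ᵍ (x ∷ u) (y ∷ v) (x≤y ∷ le) (suc i) = ≤ᵛ⇒≤ᵍ u v le i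

values-injective : {u v : Grid k n} → values u ≡ values v → u ≡ v
values-injective {u = []}    {[]}    eq = refl
values-injective {u = x ∷ u} {y ∷ v} eq =
  cong₂ _∷_ (toℕ-injective (Vec.∷-injectiveˡ eq)) (values-injective (Vec.∷-injectiveʳ eq))

values<k : (u : Grid k n) → VecAll.All (_< k) (values u)
values<k []      = []
values<k (x ∷ u) = toℕ<n x ∷ values<k u

rank-mono : {u v : Vec ℕ m} → u ≤ᵛ v → rank u ≤ rank v
rank-mono []         = z≤n
rank-mono (x≤y ∷ le) = +-mono-≤ x≤y (rank-mono le)

rank-strict : {u v : Vec ℕ m} → u ≤ᵛ v → rank u ≡ rank v → u ≡ v
rank-strict []                             eq = refl
rank-strict {u = x ∷ u} {y ∷ v} (x≤y ∷ le) eq with x ≟ y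
... | yes refl = cong (x ∷_) (rank-strict le (+-cancelˡ-≡ x _ _ eq))
... | no x≢y   = ⊥-elim (<-irrefl eq (+-mono-<-≤ (≤∧≢⇒< x≤y x≢y) (rank-mono le)))

layer : ∀ k n → ℕ → List (Grid k n)
layer k n c = filter (λ v → rank (values v) ≟ c) (allGrid k n)

layer-antichain : ∀ k n c → IsAntichain _≤ᵍ_ (layer k n c)
layer-antichain k n c = unique , antichain (layer k n c) unique (λ v∈ → proj₂ (∈-filter⁻ (λ v → rank (values v) ≟ c) {xs = allGrid k n} v∈))
  where
  unique : Unique (layer k n c)
  unique = Unique.filter⁺ (λ v → rank (values v) ≟ c) (unique-tuples n (Unique.allFin⁺ k))
  antichain : ∀ (xs : List (Grid k n)) → Unique xs → (∀ {v} → v ∈ xs → rank (values v) ≡ c) →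
    AllPairs (λ u v → ¬ Comparable _≤ᵍ_ u v) xs
  antichain []       _            _    = []
  antichain (u ∷ xs) (u≢ ∷ uniq) rank≡ = All.tabulate incomparable ∷ antichain xs uniq (rank≡ ∘ there)
    where
    incomparable : ∀ {v} → v ∈ xs → ¬ Comparable _≤ᵍ_ u v
    incomparable v∈ (inj₁ u≤v) = All.lookup u≢ v∈ (values-injective
      (rank-strict (≤ᵍ⇒≤ᵛ u _ u≤v) (trans (rank≡ (here refl)) (sym (rank≡ (there v∈))))))
    incomparable v∈ (inj₂ v≤u) = All.lookup u≢ v∈ (sym (values-injective
      (rank-strict (≤ᵍ⇒≤ᵛ _ u v≤u) (trans (rank≡ (there v∈)) (sym (rank≡ (here refl)))))))

layer≤width : ∀ {w} → IsWidth (_≤ᵍ_ {k} {n}) w → ∀ c → count (λ v → rank v ≟ c) (words k n) ≤ w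
layer≤width {k} {n} isW c = ≤-trans (≤-reflexive (trans (sym (∑-δ-count rank c (words k n)))
  (trans (∑-words-allGrid k n (δ c ∘ rank)) (∑-δ-count (rank ∘ values) c (allGrid k n)))))
  (proj₂ isW (layer k n c) (layer-antichain k n c))

-- The grid version and the subset version

grid-trivial : (u v : Grid 1 n) → u ≡ v
grid-trivial []         []         = refl
grid-trivial (zero ∷ u) (zero ∷ v) = cong (zero ∷_) (grid-trivial u v)

≤ᵍ-refl : (u : Grid k n) → u ≤ᵍ u
≤ᵍ-refl u i = ≤-refl

-- For k = 1 the step ⌊k/2⌋ of the cubes would be 0, so this case is separate: the grid is one
-- point, and all factors on the right are positive unless `F` is empty.
trivial-grid-bound : (P : FinPoset) → ∀ {c h n w} → 1 ≤ c → IsHeight (FinPoset._≼_ P) h →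
  IsWidth (_≤ᵍ_ {1} {n}) w → (F : List (Grid 1 n)) → Unique F → ¬ ContainsWeakCopy P _≤ᵍ_ F →
  length F ^ 2 ≤ (c * w * h) ^ 2 * ⌈log₂ FinPoset.size P ⌉ ^ 3
trivial-grid-bound P 1≤c isH isW []          _ _ = z≤n
trivial-grid-bound P 1≤c isH isW (x ∷ y ∷ _) ((x≢y ∷ _) ∷ _) _ = ⊥-elim (x≢y (grid-trivial x y))
trivial-grid-bound P {c} {h} {n} {w} 1≤c isH isW (x ∷ []) _ noCopy with FinPoset.size P ≤? 1
... | yes size≤1 = case small-poset P _≤ᵍ_ (λ {u} → ≤ᵍ-refl u) size≤1 (x ∷ []) noCopy of λ ()
... | no size≰1  = *-mono-≤ (^-monoˡ-≤ 2 (*-mono-≤ (*-mono-≤ 1≤c 1≤w) 1≤h))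
                            (^-monoˡ-≤ 3 (1≤⌈log₂⌉ (≰⇒> size≰1)))
  where
  1≤w : 1 ≤ w
  1≤w = proj₂ isW (x ∷ []) (([] ∷ []) , ([] ∷ []))
  1≤h : 1 ≤ h
  1≤h = proj₂ isH (fromℕ< (≰⇒> size≰1) ∷ []) (([] ∷ []) , ([] ∷ []))

cancel-core : ∀ {f X a h l Y b w} → 0 < X → f ^ 2 * X ≤ 144 * a ^ 2 * (h ^ 2 * l * Y) → Y ≤ b * b * X * w ^ 2 →
  f ^ 2 ≤ (12 * (b * a) * w * h) ^ 2 * l
cancel-core {f} {X} {a} {h} {l} {Y} {b} {w} 0<X f²≤ Y≤ = *-cancelʳ-≤ _ _ X {{>-nonZero 0<X}} (begin
  f ^ 2 * X                                            ≤⟨ f²≤ ⟩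
  144 * a ^ 2 * (h ^ 2 * l * Y)                        ≤⟨ *-monoʳ-≤ (144 * a ^ 2) (*-monoʳ-≤ (h ^ 2 * l) Y≤) ⟩
  144 * a ^ 2 * (h ^ 2 * l * (b * b * X * w ^ 2))      ≡⟨ ring a h l X b w ⟩
  (12 * (b * a) * w * h) ^ 2 * l * X                   ∎)
  where
  open ≤-Reasoning
  ring : ∀ a h l x b w → 144 * (a * (a * 1)) * (h * (h * 1) * l * (b * b * x * (w * (w * 1))))
    ≡ 12 * (b * a) * w * h * (12 * (b * a) * w * h * 1) * l * x
  ring = solve-∀

grid-version : ∀ {c} → 72 ≤ c → (P : FinPoset) (h k n w : ℕ) → IsHeight (FinPoset._≼_ P) h → 0 < k → 0 < n →
  FinPoset.size P ^ 2 ≤ 2 ^ n → IsWidth (_≤ᵍ_ {k} {n}) w →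
  (F : List (Grid k n)) → Unique F → ¬ ContainsWeakCopy P _≤ᵍ_ F →
  length F ^ 2 ≤ (12 * (8 * c) * w * h) ^ 2 * ⌈log₂ FinPoset.size P ⌉ ^ 3
grid-version 72≤c P h 1 n w isH _ _ _ isW F uniq noCopy =
  trivial-grid-bound P (*-mono-≤ {1} {12} (s≤s z≤n) (*-mono-≤ {1} {8} (s≤s z≤n) (≤-trans (s≤s z≤n) 72≤c))) isH isW F uniq noCopy
grid-version {c} 72≤c P h k@(suc (suc q)) n@(suc n′) w isH _ _ size≤ isW F uniq noCopy =
  cancel-core {length F} {n * k ^ 2} {c} {h} {⌈log₂ FinPoset.size P ⌉ ^ 3} {(k ^ n) ^ 2} {8} {w}
    (s≤s z≤n)
    (core-bound P _≤ᵍ_ (λ {u} → ≤ᵍ-refl u) 72≤c isH (s≤s (s≤s z≤n)) size≤ values values-injective (≤ᵛ⇒≤ᵍ _ _) values<k F uniq noCopy)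
    (width-lower (suc q) n′ w (layer≤width isW))

bit : Bool → ℕ
bit true  = 1
bit false = 0

bits : Subset n → Vec ℕ n
bits = Vec.map bit

bits-injective : {u v : Subset n} → bits u ≡ bits v → u ≡ v
bits-injective {u = []}    {[]}    eq = refl
bits-injective {u = x ∷ u} {y ∷ v} eq = cong₂ _∷_ (bit-injective x y (Vec.∷-injectiveˡ eq)) (bits-injective (Vec.∷-injectiveʳ eq))
  where
  bit-injective : ∀ x y → bit x ≡ bit y → x ≡ y
  bit-injective true  true  _ = refl
  bit-injective false false _ = refl

bits<2 : (u : Subset n) → VecAll.All (_< 2) (bits u)
bits<2 []          = []
bits<2 (true  ∷ u) = s≤s (s≤s z≤n) ∷ bits<2 u
bits<2 (false ∷ u) = s≤s z≤n ∷ bits<2 u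

bits-⊆ : (u v : Subset n) → bits u ≤ᵛ bits v → u ⊆ v
bits-⊆ (true ∷ u) (true ∷ v)  (_ ∷ le)  here      = here
bits-⊆ (true ∷ u) (false ∷ v) (() ∷ le) here
bits-⊆ (_ ∷ u)    (_ ∷ v)     (_ ∷ le)  (there p) = there (bits-⊆ u v le p)

/2≡⌊/2⌋ : ∀ n → n / 2 ≡ ⌊ n /2⌋
/2≡⌊/2⌋ n = trans (sym (half-of (n % 2) (n / 2) (m%n<n n 2))) (cong ⌊_/2⌋ (sym (m≡m%n+[m/n]*n n 2)))
  where
  half-of : ∀ r s → r < 2 → ⌊ r + s * 2 /2⌋ ≡ s
  half-of r (suc s) r<2 = trans (cong ⌊_/2⌋ (trans (+-suc r _) (cong suc (+-suc r _)))) (cong suc (half-of r s r<2))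
  half-of 0 zero _ = refl
  half-of 1 zero _ = refl
  half-of (suc (suc r)) zero (s≤s (s≤s ()))

-- Subsets are words over two letters, and `middle-lower` takes the place of the Chebyshev bound.
-- The slack between 2(n+1) and 256 n lets the constant 8 of the grid version serve here too.
subset-version : ∀ {c} → 72 ≤ c → (P : FinPoset) (h n : ℕ) → IsHeight (FinPoset._≼_ P) h → 0 < n →
  FinPoset.size P ^ 2 ≤ 2 ^ n → (F : List (Subset n)) → Unique F → ¬ ContainsWeakCopy P _⊆_ F →
  length F ^ 2 ≤ (12 * (8 * c) * (n C (n / 2)) * h) ^ 2 * ⌈log₂ FinPoset.size P ⌉ ^ 3
subset-version {c} 72≤c P h n@(suc n′) isH _ size≤ F uniq noCopy =
  cancel-core {length F} {n * 2 ^ 2} {c} {h} {⌈log₂ FinPoset.size P ⌉ ^ 3} {(2 ^ n) ^ 2} {8} {b}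
    (s≤s z≤n)
    (core-bound P _⊆_ id 72≤c isH ≤-refl size≤ bits bits-injective (bits-⊆ _ _) bits<2 F uniq noCopy)
    (begin
      (2 ^ n) ^ 2                       ≡⟨ trans (cong (2 ^ n *_) (*-identityʳ (2 ^ n))) (sym (^-distribʳ-* n 2 2)) ⟩
      4 ^ n                             ≤⟨ middle-lower n ⟩
      2 * suc n * (middle n * middle n) ≡⟨ cong (λ b → 2 * suc n * (b * b)) (cong (n C_) (sym (/2≡⌊/2⌋ n))) ⟩
      2 * suc n * (b * b)               ≤⟨ m≤m+n _ ((254 * n′ + 252) * (b * b)) ⟩
      2 * suc n * (b * b) + (254 * n′ + 252) * (b * b) ≡⟨ ring n′ b ⟩
      64 * (n * 4) * b ^ 2              ∎)
  where
  open ≤-Reasoning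
  b = n C (n / 2)
  ring : ∀ n b → 2 * suc (suc n) * (b * b) + (254 * n + 252) * (b * b) ≡ 64 * (suc n * 4) * (b * (b * 1))
  ring = solve-∀

theorem5 : Σ ℕ λ c → 0 < c
    × ((P : FinPoset) (h k n w : ℕ) → IsHeight (FinPoset._≼_ P) h → 0 < k → 0 < n
    → FinPoset.size P ^ 2 ≤ 2 ^ n
    → IsWidth (_≤ᵍ_ {k} {n}) w
    → (F : List (Grid k n)) → Unique F → ¬ ContainsWeakCopy P _≤ᵍ_ F
    → length F ^ 2 ≤ (c * w * h) ^ 2 * ⌈log₂ FinPoset.size P ⌉ ^ 3)
    × ((P : FinPoset) (h n : ℕ) → IsHeight (FinPoset._≼_ P) h → 0 < n
    → FinPoset.size P ^ 2 ≤ 2 ^ n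
    → (F : List (Subset n)) → Unique F → ¬ ContainsWeakCopy P _⊆_ F
    → length F ^ 2 ≤ (c * (n C (n / 2)) * h) ^ 2 * ⌈log₂ FinPoset.size P ⌉ ^ 3)
-- 72 is the constant for one grid and 8 that of the width estimate. 12² = 9 · 2 · 8 collects 3²
-- from `cube-window`, the 2 in n ≤ 2Dm, and (L+1)³ ≤ 8L³.
theorem5 = 12 * (8 * 72) , s≤s z≤n , grid-version ≤-refl , subset-version ≤-refl
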